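{- Let $d\ge 1$ and let $\mathbf{s}=(s_1,\ldots,s_d)$ be a strictly increasing sequence of positive integers such that $\mathbf{P}_d^{(\mathbf{s})}$ is translation equivalent to a Fano polytope. Set $s_0=1$ and $k_i=s_{i+1}-s_i$ for $0\le i\le d-1$. Then $\mathbf{P}_d^{(\mathbf{s})}$ is reflexive up to translation (that is, translation equivalent to a reflexive polytope) if and only if for each $0\le i\le d-1$ one has $k_i\mid s_i$ and $k_i\mid s_{i+1}$.
   Context: For a sequence of positive integers $\mathbf{s}=(s_1,\ldots,s_d)$, the $\mathbf{s}$-lecture hall polytope is $\mathbf{P}_d^{(\mathbf{s})}=\{\mathbf{x}\in\mathbb{R}^d : 0\le \frac{x_1}{s_1}\le\frac{x_2}{s_2}\le\cdots\le\frac{x_d}{s_d}\le 1\}$, a $d$-dimensional lattice polytope. A $d$-dimensional lattice polytope $\mathcal{P}\subset\mathbb{R}^d$ is Fano if $(\mathcal{P}\setminus\partial\mathcal{P})\cap\mathbb{Z}^d=\{\mathbf{0}\}$. It is reflexive if it is Fano and its dual polytope $\mathcal{P}^\vee=\{y\in\mathbb{R}^d : \langle x,y\rangle\le 1 \text{ for all } x\in\mathcal{P}\}$ is a lattice polytope. Two lattice polytopes are translation equivalent if one is the translate of the other by a vector in $\mathbb{Z}^d$. -}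

module Defs where

open import Level using (suc)
open import Algebra.Apartness.Bundles using (HeytingField; HeytingCommutativeRing)
open import Algebra.Bundles using (CommutativeRing)
open import Data.Fin.Base as Fin using (Fin; inject₁)
open import Data.Integer.Base using (ℤ; +_; -[1+_]; 0ℤ)
open import Data.List.Base as List using ([_])
open import Data.List.Relation.Unary.Linked using (Linked)
open import Data.Nat.Base as ℕ using (ℕ; NonZero; _∸_)
open import Data.Product.Base using (∃-syntax; Σ-syntax; _×_; proj₁)
open import Data.Sum.Base using (_⊎_; [_,_]′)
open import Data.Vec.Functional using (Vector; toList; _∷_)
open import Function.Base using (id)
open import Function.Bundles using (_⇔_)
open import Relation.Binary.Core using (Rel)
open import Relation.Binary.Structures using (IsStrictPartialOrder)
open import Relation.Nullary.Negation using (¬_)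
open import Relation.Unary using (Pred; _∈_; _≐_)
open import Relation.Binary.PropositionalEquality.Core using (_≡_)
import Algebra.Apartness.Properties.HeytingCommutativeRing as HCRProperties
import Algebra.Definitions.RawMonoid as RawMonoidOps
import Algebra.Properties.Ring as RingProperties

-- The real numbers, given axiomatically: a Cauchy complete Archimedean ordered
-- field. Classically these axioms determine ℝ up to isomorphism.
-- Constructively they are those satisfied by the Bishop reals: the order is
-- not assumed decidable, and trichotomy is only available for apart elements.

record Reals ℓ : Set (suc ℓ) where
  infix 4 _<_ _≤_

  field
    heytingField : HeytingField ℓ ℓ ℓ

  open HeytingField heytingField public

  field
    _<_                  : Rel Carrier ℓ
    isStrictPartialOrder : IsStrictPartialOrder _≈_ _<_
    <⇒#                  : ∀ {x y} → x < y → x # y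
    #⇒<⊎>                : ∀ {x y} → x # y → x < y ⊎ y < x
    +-monoˡ-<            : ∀ z {x y} → x < y → x + z < y + z
    *-pos                : ∀ {x y} → 0# < x → 0# < y → 0# < x * y

  open IsStrictPartialOrder isStrictPartialOrder public
    using (<-resp-≈; <-respˡ-≈; <-respʳ-≈)
    renaming (irrefl to <-irrefl; trans to <-trans; asym to <-asym)

  _≤_ : Rel Carrier ℓ
  x ≤ y = ¬ (y < x)

  commutativeRing : CommutativeRing ℓ ℓ
  commutativeRing =
    HeytingCommutativeRing.commutativeRing heytingCommutativeRing

  open CommutativeRing commutativeRing public using (ring; +-rawMonoid)

  open RawMonoidOps +-rawMonoid public using (sum) renaming (_×_ to _·_)

  fromℕ : ℕ → Carrier
  fromℕ n = n · 1#

  -- The hypothesis of `complete` is the usual |u m - u n| < ε, with the two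
  -- bounds obtained by exchanging m and n.
  field
    archimedean : ∀ x → ∃[ n ] x < fromℕ n
    complete    : (u : ℕ → Carrier) →
                  (∀ ε → 0# < ε →
                    ∃[ N ] (∀ m n → N ℕ.≤ m → N ℕ.≤ n → u m < u n + ε)) →
                  ∃[ l ] (∀ ε → 0# < ε →
                    ∃[ N ] (∀ n → N ℕ.≤ n → u n < l + ε × l < u n + ε))

  fromℤ : ℤ → Carrier
  fromℤ (+ n)    = fromℕ n
  fromℤ -[1+ n ] = - fromℕ (ℕ.suc n)

  0<1 : 0# < 1#
  0<1 = [ 1<0⇒0<1 , id ]′ (#⇒<⊎> (HCRProperties.1#0 heytingCommutativeRing))
    where
    open RingProperties ring using (-‿distribˡ-*; -‿involutive)

    1<0⇒0<1 : 1# < 0# → 0# < 1#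
    1<0⇒0<1 1<0 = <-respʳ-≈ -1*-1≈1 (*-pos 0<-1 0<-1)
      where
      0<-1 : 0# < - 1#
      0<-1 = <-respˡ-≈ (-‿inverseʳ 1#)
               (<-respʳ-≈ (+-identityˡ (- 1#)) (+-monoˡ-< (- 1#) 1<0))

      -1*-1≈1 : - 1# * - 1# ≈ 1#
      -1*-1≈1 = trans (sym (-‿distribˡ-* 1# (- 1#)))
                  (trans (-‿cong (*-identityˡ (- 1#))) (-‿involutive 1#))

  0<fromℕ : ∀ n .{{_ : NonZero n}} → 0# < fromℕ n
  0<fromℕ (ℕ.suc ℕ.zero)    = <-respʳ-≈ (sym (+-identityʳ 1#)) 0<1
  0<fromℕ (ℕ.suc (ℕ.suc n)) =
    <-trans (0<fromℕ (ℕ.suc n))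
      (<-respˡ-≈ (+-identityˡ (fromℕ (ℕ.suc n)))
        (+-monoˡ-< (fromℕ (ℕ.suc n)) 0<1))

  recip : ∀ n .{{_ : NonZero n}} → Carrier
  recip n = proj₁ (#⇒invertible (#-sym (<⇒# (0<fromℕ n))))

  infixl 7 _/_
  _/_ : Carrier → ∀ n .{{_ : NonZero n}} → Carrier
  x / n = x * recip n

-- s₀ = 1 is put in front, so that the entry of s₀∷ s at position i is sᵢ for
-- 0 ≤ i ≤ d, whereas the entries of s itself are s₁ , … , s_d.

s₀∷ : ∀ {d} → Vector ℕ d → Vector ℕ (ℕ.suc d)
s₀∷ s = 1 ∷ s

-- For an increasing sequence of positive integers the subtraction is never
-- truncated.

gap : ∀ {d} → Vector ℕ d → Vector ℕ d
gap s i = s₀∷ s (Fin.suc i) ∸ s₀∷ s (inject₁ i)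

module Polytopes {ℓ} (ℝ : Reals ℓ) where

  open Reals ℝ

  Point : ℕ → Set ℓ
  Point d = Vector Carrier d

  infix 4 _≋_
  _≋_ : ∀ {d} → Rel (Point d) ℓ
  x ≋ y = ∀ i → x i ≈ y i

  Region : ℕ → Set (suc ℓ)
  Region d = Pred (Point d) ℓ

  lattice : ∀ {d} → Vector ℤ d → Point d
  lattice z i = fromℤ (z i)

  ⟨_,_⟩ : ∀ {d} → Point d → Point d → Carrier
  ⟨ x , y ⟩ = sum (λ i → x i * y i)

  combination : ∀ {n d} → Vector Carrier n → Vector (Point d) n → Point d
  combination a p j = sum (λ i → a i * p i j)

  convexHull : ∀ {n d} → Vector (Point d) n → Region d
  convexHull p x =
    ∃[ a ] (∀ i → 0# ≤ a i) × sum a ≈ 1# × x ≋ combination a p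

  affineHull : ∀ {d} → Region d → Region d
  affineHull {d} P x =
    ∃[ n ] ∃[ p ] ∃[ a ]
      (∀ (i : Fin n) → p i ∈ P) × sum a ≈ 1# × x ≋ combination a p

  -- The topological interior, i.e. P without its boundary; balls are taken
  -- in the maximum norm.
  interior : ∀ {d} → Region d → Region d
  interior P x =
    ∃[ ε ] 0# < ε ×
      (∀ y → (∀ i → x i < y i + ε × y i < x i + ε) → y ∈ P)

  dual : ∀ {d} → Region d → Region d
  dual P y = ∀ x → x ∈ P → ⟨ x , y ⟩ ≤ 1#

  translate : ∀ {d} → Vector ℤ d → Region d → Region d
  translate t P x = (λ i → x i - fromℤ (t i)) ∈ P

  TranslationEquivalent : ∀ {d} → Rel (Region d) ℓ
  TranslationEquivalent P Q = ∃[ t ] P ≐ translate t Q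

  IsLatticePolytope : ∀ {d} → Region d → Set ℓ
  IsLatticePolytope {d} P =
    ∃[ n ] Σ[ v ∈ Vector (Vector ℤ d) n ] P ≐ convexHull (λ i → lattice (v i))

  IsFullDimensional : ∀ {d} → Region d → Set ℓ
  IsFullDimensional P = ∀ x → x ∈ affineHull P

  record IsFano {d} (P : Region d) : Set ℓ where
    field
      isLatticePolytope : IsLatticePolytope P
      isFullDimensional : IsFullDimensional P
      interiorLattice   : ∀ z → lattice z ∈ interior P ⇔ (∀ i → z i ≡ 0ℤ)

  record IsReflexive {d} (P : Region d) : Set ℓ where
    field
      isFano                : IsFano P
      dualIsLatticePolytope : IsLatticePolytope (dual P)

  -- 0 ≤ x₁/s₁ ≤ … ≤ x_d/s_d ≤ 1
  lectureHall : ∀ {d} (s : Vector ℕ d) → (∀ i → NonZero (s i)) → Region d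
  lectureHall s s≢0 x =
    Linked _≤_ (0# List.∷ toList (λ i → (x i / s i) {{s≢0 i}}) List.++ [ 1# ])

{-# OPTIONS --safe #-}

-- Moving the only interior lattice point s - 1 of the lecture hall polytope to
-- the origin turns it into Q and puts its facets sᵢ₊₁ uᵢ - sᵢ uᵢ₊₁ ≤ kᵢ (with
-- u₀ = 0 and s₀ = 1) and u_d ≤ 1 in a form from which the dual can be read off:
-- dual Q is the simplex with vertices (sᵢ₊₁ eᵢ - sᵢ eᵢ₊₁) / kᵢ and e_d. Writing
-- Y = (1 - Σ y , y), the slack of y at the m-th vertex of Q is the partial sum
-- Σ_{i ≤ m} sᵢ Yᵢ, so summation by parts gives the barycentric coordinates of y
-- in that simplex. Divisibility says that its vertices are integral. Conversely,
-- if dual Q is a hull of lattice points, then one that occurs with positive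
-- weight in such a vertex has the same vanishing slacks, hence equals it.
-- Divisibility is decidable, so this can be argued by contradiction, without
-- locating a positive weight.

module Submission where

open import Defs
open import Algebra.Solver.Ring.AlmostCommutativeRing using (_-Raw-AlmostCommutative⟶_; fromCommutativeRing)
open import Data.Fin.Base as Fin using (Fin; inject₁)
open import Data.Fin.Induction using (>-weakInduction)
open import Data.Integer.Base as ℤ using (ℤ; +_; -[1+_]; _⊖_)
open import Data.List.Base as List using (List)
open import Data.List.Relation.Unary.Linked as Linked using (Linked; [-])
open import Data.Maybe.Base using (Maybe; just; nothing)
open import Data.Nat.Base as ℕ using (ℕ; NonZero)
open import Data.Nat.Divisibility using (_∣_; _∣?_; divides; quotient; ∣-reflexive; ∣m∣n⇒∣m+n)
open import Data.Product.Base using (∃-syntax; _×_; _,_; proj₁; proj₂)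
open import Data.Sum.Base using (_⊎_; inj₁; inj₂; [_,_]′)
open import Data.Vec.Functional using (Vector; toList; _∷_)
open import Function.Base using (id; _∘_; case_of_)
open import Function.Bundles using (_⇔_; mk⇔; Equivalence)
open import Relation.Binary.Core using (Rel; _Preserves_⟶_)
open import Relation.Binary.PropositionalEquality.Core as ≡ using (_≡_)
open import Relation.Nullary.Decidable.Core using (yes; no)
open import Relation.Nullary.Negation using (¬_; contradiction)
open import Relation.Unary using (_∈_)
import Algebra.Apartness.Properties.HeytingCommutativeRing as HCRProperties
import Algebra.Bundles
import Algebra.Properties.AbelianGroup as AbelianGroupProperties
import Algebra.Properties.Monoid.Mult as MonoidMult
import Algebra.Properties.Monoid.Mult.TCOptimised as TCMult
import Algebra.Properties.Ring as RingProperties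
import Algebra.Properties.Semiring.Mult as SemiringMult
import Algebra.Properties.Semiring.Sum as SemiringSum
import Algebra.Solver.Ring as RingSolver
import Data.Fin.Properties as Fin
import Data.Integer.Properties as ℤ
import Data.Nat.Properties as ℕ
import Relation.Binary.Reasoning.Setoid as SetoidReasoning

module RealProperties {ℓ} (ℝ : Reals ℓ) where

  open Reals ℝ
  open HCRProperties heytingCommutativeRing using (x-0≈x; invertibleˡ⇒#; #-congʳ; 1#0)
  module R = Algebra.Bundles.CommutativeRing commutativeRing
  open RingProperties ring using (-‿distribˡ-*; -‿distribʳ-*; -‿involutive; -0#≈0#)
  open AbelianGroupProperties R.+-abelianGroup using (⁻¹-∙-comm)
  open MonoidMult R.+-monoid using (×-homo-+)
  open TCMult R.+-monoid using (×ᵤ≈×) renaming (_×_ to _ו_)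
  open SemiringMult R.semiring using (×1-homo-*)
  open SetoidReasoning setoid

  -- The embedding of ℤ

  fromℤ-⊖ : ∀ m n → fromℤ (m ⊖ n) ≈ fromℕ m - fromℕ n
  fromℤ-⊖ m ℕ.zero = begin
    fromℕ m         ≈⟨ x-0≈x (fromℕ m) ⟨
    fromℕ m - 0#    ∎
  fromℤ-⊖ ℕ.zero (ℕ.suc n) = sym (+-identityˡ _)
  fromℤ-⊖ (ℕ.suc m) (ℕ.suc n) = begin
    fromℤ (ℕ.suc m ⊖ ℕ.suc n)                 ≡⟨ ≡.cong fromℤ (ℤ.[1+m]⊖[1+n]≡m⊖n m n) ⟩
    fromℤ (m ⊖ n)                             ≈⟨ fromℤ-⊖ m n ⟩
    fromℕ m - fromℕ n                         ≈⟨ +-congʳ (+-identityʳ (fromℕ m)) ⟨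
    fromℕ m + 0# - fromℕ n                    ≈⟨ +-congʳ (+-congˡ (-‿inverseʳ 1#)) ⟨
    fromℕ m + (1# - 1#) - fromℕ n             ≈⟨ +-congʳ (+-assoc _ _ _) ⟨
    fromℕ m + 1# - 1# - fromℕ n               ≈⟨ +-assoc _ _ _ ⟩
    fromℕ m + 1# + (- 1# - fromℕ n)           ≈⟨ +-cong (+-comm _ _) (⁻¹-∙-comm 1# (fromℕ n)) ⟩
    1# + fromℕ m - (1# + fromℕ n)             ∎

  fromℤ-neg : ∀ i → fromℤ (ℤ.- i) ≈ - fromℤ i
  fromℤ-neg (+ ℕ.zero)  = sym -0#≈0#
  fromℤ-neg (+ ℕ.suc n) = refl
  fromℤ-neg -[1+ n ]    = sym (-‿involutive _)

  fromℤ-+ : ∀ i j → fromℤ (i ℤ.+ j) ≈ fromℤ i + fromℤ j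
  fromℤ-+ (+ m)    (+ n)    = ×-homo-+ 1# m n
  fromℤ-+ (+ m)    -[1+ n ] = fromℤ-⊖ m (ℕ.suc n)
  fromℤ-+ -[1+ m ] (+ n)    = trans (fromℤ-⊖ n (ℕ.suc m)) (+-comm _ _)
  fromℤ-+ -[1+ m ] -[1+ n ] = begin
    - fromℕ (ℕ.suc (ℕ.suc (m ℕ.+ n)))      ≡⟨ ≡.cong (λ k → - fromℕ (ℕ.suc k)) (ℕ.+-suc m n) ⟨
    - fromℕ (ℕ.suc m ℕ.+ ℕ.suc n)          ≈⟨ -‿cong (×-homo-+ 1# (ℕ.suc m) (ℕ.suc n)) ⟩
    - (fromℕ (ℕ.suc m) + fromℕ (ℕ.suc n))  ≈⟨ ⁻¹-∙-comm _ _ ⟨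
    - fromℕ (ℕ.suc m) - fromℕ (ℕ.suc n)    ∎

  fromℤ-minus : ∀ i j → fromℤ (i ℤ.- j) ≈ fromℤ i - fromℤ j
  fromℤ-minus i j = trans (fromℤ-+ i (ℤ.- j)) (+-congˡ (fromℤ-neg j))

  fromℤ-+*ˡ : ∀ m j → fromℤ (+ m ℤ.* j) ≈ fromℕ m * fromℤ j
  fromℤ-+*ˡ m (+ n)    = trans (reflexive (≡.cong fromℤ (≡.sym (ℤ.pos-* m n)))) (×1-homo-* m n)
  fromℤ-+*ˡ m -[1+ n ] = begin
    fromℤ (+ m ℤ.* -[1+ n ])         ≡⟨ ≡.cong fromℤ (ℤ.neg-distribʳ-* (+ m) (+ ℕ.suc n)) ⟨
    fromℤ (ℤ.- (+ m ℤ.* + ℕ.suc n))  ≈⟨ fromℤ-neg (+ m ℤ.* + ℕ.suc n) ⟩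
    - fromℤ (+ m ℤ.* + ℕ.suc n)      ≈⟨ -‿cong (fromℤ-+*ˡ m (+ ℕ.suc n)) ⟩
    - (fromℕ m * fromℕ (ℕ.suc n))    ≈⟨ -‿distribʳ-* _ _ ⟩
    fromℕ m * - fromℕ (ℕ.suc n)      ∎

  fromℤ-* : ∀ i j → fromℤ (i ℤ.* j) ≈ fromℤ i * fromℤ j
  fromℤ-* (+ m)    j = fromℤ-+*ˡ m j
  fromℤ-* -[1+ m ] j = begin
    fromℤ (-[1+ m ] ℤ.* j)         ≡⟨ ≡.cong fromℤ (ℤ.neg-distribˡ-* (+ ℕ.suc m) j) ⟨
    fromℤ (ℤ.- (+ ℕ.suc m ℤ.* j))  ≈⟨ fromℤ-neg (+ ℕ.suc m ℤ.* j) ⟩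
    - fromℤ (+ ℕ.suc m ℤ.* j)      ≈⟨ -‿cong (fromℤ-+*ˡ (ℕ.suc m) j) ⟩
    - (fromℕ (ℕ.suc m) * fromℤ j)  ≈⟨ -‿distribˡ-* _ _ ⟩
    - fromℕ (ℕ.suc m) * fromℤ j    ∎

  -- The solver interprets constants by a variant of fromℤ that sends 1 to 1#
  -- definitionally.

  constant : ℤ → Carrier
  constant (+ n)    = n ו 1#
  constant -[1+ n ] = - (ℕ.suc n ו 1#)

  constant≈fromℤ : ∀ i → constant i ≈ fromℤ i
  constant≈fromℤ (+ n)    = sym (×ᵤ≈× n 1#)
  constant≈fromℤ -[1+ n ] = -‿cong (sym (×ᵤ≈× (ℕ.suc n) 1#))

  constantMorphism : ℤ.+-*-rawRing -Raw-AlmostCommutative⟶ fromCommutativeRing commutativeRing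
  constantMorphism = record
    { ⟦_⟧    = constant
    ; +-homo = λ i j → trans (constant≈fromℤ (i ℤ.+ j))
        (trans (fromℤ-+ i j) (sym (+-cong (constant≈fromℤ i) (constant≈fromℤ j))))
    ; *-homo = λ i j → trans (constant≈fromℤ (i ℤ.* j))
        (trans (fromℤ-* i j) (sym (*-cong (constant≈fromℤ i) (constant≈fromℤ j))))
    ; -‿homo = λ i → trans (constant≈fromℤ (ℤ.- i))
        (trans (fromℤ-neg i) (sym (-‿cong (constant≈fromℤ i))))
    ; 0-homo = refl
    ; 1-homo = refl
    }

  constant≟ : ∀ i j → Maybe (constant i ≈ constant j)
  constant≟ i j with i ℤ.≟ j
  ... | yes i≡j = just (reflexive (≡.cong constant i≡j))
  ... | no _    = nothing

  module Solver = RingSolver ℤ.+-*-rawRing (fromCommutativeRing commutativeRing) constantMorphism constant≟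
  open Solver using (solve; _:=_; _:+_; _:*_; _:-_; :-_; con)

  -- Identities modulo hypotheses: the solver checks that the difference of the two
  -- sides is a combination of the differences of the hypotheses.
  eq₁ : ∀ {x y a b c} → a ≈ b → x - y ≈ c * (a - b) → x ≈ y
  eq₁ {x} {y} {a} {b} {c} a≈b x-y≈ = begin
    x                ≈⟨ solve 2 (λ x y → x := x :- y :+ y) refl x y ⟩
    x - y + y        ≈⟨ +-congʳ x-y≈ ⟩
    c * (a - b) + y  ≈⟨ +-congʳ (*-congˡ (+-congʳ a≈b)) ⟩
    c * (b - b) + y  ≈⟨ solve 3 (λ c b y → c :* (b :- b) :+ y := y) refl c b y ⟩
    y                ∎

  eq₂ : ∀ {x y a b c a′ b′ c′} → a ≈ b → a′ ≈ b′ →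
        x - y ≈ c * (a - b) + c′ * (a′ - b′) → x ≈ y
  eq₂ {x} {y} {a} {b} {c} {a′} {b′} {c′} a≈b a′≈b′ x-y≈ =
    eq₁ a≈b (eq₁ a′≈b′ (begin
      x - y - c * (a - b)                          ≈⟨ +-congʳ x-y≈ ⟩
      c * (a - b) + c′ * (a′ - b′) - c * (a - b)   ≈⟨ solve 2 (λ p q → p :+ q :- p := q) refl _ _ ⟩
      c′ * (a′ - b′)                               ∎))

  -- Order

  -- The constructive substitute for trichotomy, inherited from cotransitivity of apartness: `y` is
  -- apart from one of the endpoints, and either order with that endpoint yields one of the
  -- alternatives, if need be by transitivity.
  <-cotrans : ∀ {x z} → x < z → ∀ y → x < y ⊎ y < z
  <-cotrans x<z y with #-cotrans (<⇒# x<z) y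
  ... | inj₁ x#y = [ inj₁ , (λ y<x → inj₂ (<-trans y<x x<z)) ]′ (#⇒<⊎> x#y)
  ... | inj₂ y#z = [ inj₂ , (λ z<y → inj₁ (<-trans x<z z<y)) ]′ (#⇒<⊎> y#z)

  <⇒≤ : ∀ {x y} → x < y → x ≤ y
  <⇒≤ = <-asym

  ≤-reflexive : ∀ {x y} → x ≈ y → x ≤ y
  ≤-reflexive x≈y = <-irrefl (sym x≈y)

  ≤-trans : ∀ {x y z} → x ≤ y → y ≤ z → x ≤ z
  ≤-trans {y = y} x≤y y≤z z<x = [ y≤z , x≤y ]′ (<-cotrans z<x y)

  <-≤-trans : ∀ {x y z} → x < y → y ≤ z → x < z
  <-≤-trans {z = z} x<y y≤z = [ id , (λ z<y → contradiction z<y y≤z) ]′ (<-cotrans x<y z)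

  -- By tightness of apartness: with both strict inequalities refuted, `x` and `y` cannot be apart.
  ≤-antisym : ∀ {x y} → x ≤ y → y ≤ x → x ≈ y
  ≤-antisym x≤y y≤x = proj₁ (tight _ _) ([ y≤x , x≤y ]′ ∘ #⇒<⊎>)

  ≤-resp₂-≈ : ∀ {x x′ y y′} → x ≈ x′ → y ≈ y′ → x ≤ y → x′ ≤ y′
  ≤-resp₂-≈ x≈x′ y≈y′ x≤y y′<x′ = x≤y (<-respˡ-≈ (sym y≈y′) (<-respʳ-≈ (sym x≈x′) y′<x′))

  ≤-respʳ-≈ : ∀ {x y y′} → y ≈ y′ → x ≤ y → x ≤ y′
  ≤-respʳ-≈ = ≤-resp₂-≈ refl

  <⇒0< : ∀ {x y} → x < y → 0# < y - x
  <⇒0< {x} x<y = <-respˡ-≈ (-‿inverseʳ x) (+-monoˡ-< (- x) x<y)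

  0<⇒< : ∀ {x y e} → 0# < e → y - x ≈ e → x < y
  0<⇒< {x} {y} 0<e y-x≈e = <-respˡ-≈ (+-identityˡ x)
    (<-respʳ-≈ (trans (+-congʳ (sym y-x≈e)) (solve 2 (λ x y → y :- x :+ x := y) refl x y))
      (+-monoˡ-< x 0<e))

  ≤⇒0≤ : ∀ {x y} → x ≤ y → 0# ≤ y - x
  ≤⇒0≤ {x} {y} x≤y y-x<0 = x≤y (0<⇒< (<⇒0< y-x<0) (solve 2 (λ x y → x :- y := con (+ 0) :- (y :- x))
      refl x y))

  -- The usual way to prove an inequality below: `e` is assembled from products of terms known to be
  -- nonnegative, and the ring solver certifies that it is the difference of the two sides.
  0≤⇒≤ : ∀ {x y e} → 0# ≤ e → y - x ≈ e → x ≤ y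
  0≤⇒≤ {x} {y} 0≤e y-x≈e y<x = 0≤e (<-respˡ-≈ y-x≈e
    (0<⇒< (<⇒0< y<x) (solve 2 (λ x y → con (+ 0) :- (y :- x) := x :- y) refl x y)))

  0<+ : ∀ {x y} → 0# < x → 0# < y → 0# < x + y
  0<+ {x} {y} 0<x 0<y = <-trans 0<y (<-respˡ-≈ (+-identityˡ y) (+-monoˡ-< y 0<x))

  0≤+ : ∀ {x y} → 0# ≤ x → 0# ≤ y → 0# ≤ x + y
  0≤+ {x} {y} 0≤x 0≤y = ≤-trans 0≤y (0≤⇒≤ 0≤x (solve 2 (λ x y → x :+ y :- y := x) refl x y))

  -- If `c` inverts `x * y`, then `c * y` inverts `x`. Zero is subtracted in the identity because
  -- inverses are supplied for differences of apart elements.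
  x*y#0⇒x#0 : ∀ {x y} → x * y # 0# → x # 0#
  x*y#0⇒x#0 {x} {y} xy#0 = case #⇒invertible xy#0 of λ (c , c*≈1 , _) →
    invertibleˡ⇒# (c * y , trans
      (solve 3 (λ c x y → c :* y :* (x :- con (+ 0)) := c :* (x :* y :- con (+ 0))) refl c x y) c*≈1)

  0≤∧#0⇒0< : ∀ {x} → 0# ≤ x → x # 0# → 0# < x
  0≤∧#0⇒0< 0≤x x#0 = [ (λ x<0 → contradiction x<0 0≤x) , id ]′ (#⇒<⊎> x#0)

  -- The signs of the factors cannot be decided, but a negative product is apart from 0. This makes
  -- both factors apart from 0, hence positive, and so is their product.
  0≤* : ∀ {x y} → 0# ≤ x → 0# ≤ y → 0# ≤ x * y
  0≤* {x} {y} 0≤x 0≤y xy<0 = <-asym xy<0 (*-pos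
    (0≤∧#0⇒0< 0≤x (x*y#0⇒x#0 (<⇒# xy<0)))
    (0≤∧#0⇒0< 0≤y (x*y#0⇒x#0 (#-congʳ (*-comm x y) (<⇒# xy<0)))))

  0≤1 : 0# ≤ 1#
  0≤1 = <⇒≤ 0<1

  0<⇒*-cancelˡ : ∀ {x y z} → 0# < x → x * y ≈ x * z → y ≈ z
  0<⇒*-cancelˡ {x} {y} {z} 0<x xy≈xz = case #⇒invertible (#-sym (<⇒# 0<x)) of λ (c , c*≈1 , _) →
    eq₂ xy≈xz c*≈1 (solve 4 (λ c x y z → y :- z :=
      c :* (x :* y :- x :* z) :+ (z :- y) :* (c :* (x :- con (+ 0)) :- con (+ 1))) refl c x y z)

  0<⇒*-cancelˡ-≤ : ∀ {x y z} → 0# < x → x * y ≤ x * z → y ≤ z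
  0<⇒*-cancelˡ-≤ {x} {y} {z} 0<x xy≤xz z<y = xy≤xz
    (0<⇒< (*-pos 0<x (<⇒0< z<y)) (solve 3 (λ x y z → x :* y :- x :* z := x :* (y :- z)) refl x y z))

  *-recip : ∀ n .{{_ : NonZero n}} → fromℕ n * recip n ≈ 1#
  *-recip n = eq₁ (proj₁ (proj₂ (#⇒invertible (#-sym (<⇒# (0<fromℕ n))))))
    (solve 2 (λ x r → x :* r :- con (+ 1) := con (+ 1) :* (r :* (x :- con (+ 0)) :- con (+ 1)))
      refl (fromℕ n) (recip n))

  0<recip : ∀ n .{{_ : NonZero n}} → 0# < recip n
  0<recip n = [ (λ r<0 → contradiction r<0 (0<⇒*-cancelˡ-≤ (0<fromℕ n)
      (≤-resp₂-≈ (sym (zeroʳ _)) (sym (*-recip n)) 0≤1))) , id ]′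
    (#⇒<⊎> (x*y#0⇒x#0 {y = fromℕ n} (#-congʳ (sym (trans (*-comm _ _) (*-recip n))) 1#0)))

  0≤fromℕ : ∀ n → 0# ≤ fromℕ n
  0≤fromℕ ℕ.zero    = ≤-reflexive refl
  0≤fromℕ (ℕ.suc n) = <⇒≤ (0<fromℕ (ℕ.suc n))

  fromℕ-∸ : ∀ {m n} → m ℕ.≤ n → fromℕ (n ℕ.∸ m) ≈ fromℕ n - fromℕ m
  fromℕ-∸ {m} {n} m≤n = trans (reflexive (≡.cong fromℤ (≡.sym (ℤ.⊖-≥ m≤n)))) (fromℤ-⊖ n m)

  fromℤ-mono-≤ : ∀ {i j} → i ℤ.≤ j → fromℤ i ≤ fromℤ j
  fromℤ-mono-≤ {i} {j} i≤j with j ℤ.- i | ℤ.i≤j⇒0≤j-i i≤j | fromℤ-minus j i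
  ... | + n | _ | n≈ = 0≤⇒≤ (0≤fromℕ n) (sym n≈)

  fromℤ-cancel-< : ∀ {i j} → fromℤ i < fromℤ j → i ℤ.< j
  fromℤ-cancel-< {i} {j} i<j with i ℤ.<? j
  ... | yes p = p
  ... | no ¬p = contradiction i<j (fromℤ-mono-≤ (ℤ.≮⇒≥ ¬p))

  fromℤ-injective : ∀ {i j} → fromℤ i ≈ fromℤ j → i ≡ j
  fromℤ-injective {i} {j} i≈j = ℤ.i-j≡0⇒i≡j i j (kernel (i ℤ.- j) (begin
      fromℤ (i ℤ.- j)          ≈⟨ fromℤ-minus i j ⟩
      fromℤ i - fromℤ j        ≈⟨ +-congʳ i≈j ⟩
      fromℤ j - fromℤ j        ≈⟨ -‿inverseʳ _ ⟩
      0#                       ∎))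
    where
    kernel : ∀ k → fromℤ k ≈ 0# → k ≡ + 0
    kernel (+ ℕ.zero)  _   = ≡.refl
    kernel (+ ℕ.suc n) k≈0 = contradiction (0<fromℕ (ℕ.suc n)) (<-irrefl (sym k≈0))
    kernel -[1+ n ]    k≈0 = contradiction (0<fromℕ (ℕ.suc n)) (<-irrefl (sym (begin
      fromℕ (ℕ.suc n)    ≈⟨ -‿involutive _ ⟨
      - fromℤ -[1+ n ]   ≈⟨ -‿cong k≈0 ⟩
      - 0#               ≈⟨ -0#≈0# ⟩
      0#                 ∎)))

  -- Finite sums

  open SemiringSum R.semiring public
    using (sum-replicate-zero; ∑-comm; *-distribˡ-sum; *-distribʳ-sum) renaming (sum-cong-≋ to sum-cong)

  sum-minus : ∀ {n} (f g : Vector Carrier n) → sum (λ i → f i - g i) ≈ sum f - sum g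
  sum-minus {ℕ.zero}  f g = sym (-‿inverseʳ 0#)
  sum-minus {ℕ.suc n} f g = begin
    f₀ - g₀ + sum (λ i → f (Fin.suc i) - g (Fin.suc i))  ≈⟨ +-congˡ (sum-minus (f ∘ Fin.suc) (g ∘ Fin.suc)) ⟩
    f₀ - g₀ + (∑f - ∑g)
      ≈⟨ solve 4 (λ a b c d → a :- b :+ (c :- d) := (a :+ c) :- (b :+ d)) refl f₀ g₀ ∑f ∑g ⟩
    (f₀ + ∑f) - (g₀ + ∑g)                                ∎
    where
    f₀ = f Fin.zero
    g₀ = g Fin.zero
    ∑f = sum (f ∘ Fin.suc)
    ∑g = sum (g ∘ Fin.suc)

  0≤sum : ∀ {n} {f : Vector Carrier n} → (∀ i → 0# ≤ f i) → 0# ≤ sum f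
  0≤sum {ℕ.zero}  0≤f = ≤-reflexive refl
  0≤sum {ℕ.suc n} 0≤f = 0≤+ (0≤f Fin.zero) (0≤sum (0≤f ∘ Fin.suc))

  sum≤0 : ∀ {n} {f : Vector Carrier n} → (∀ i → f i ≤ 0#) → sum f ≤ 0#
  sum≤0 {n} {f} f≤0 = 0≤⇒≤ (0≤sum (λ i → ≤⇒0≤ (f≤0 i))) (sym (begin
    sum (λ i → 0# - f i)       ≈⟨ sum-minus (λ _ → 0#) f ⟩
    sum {n} (λ _ → 0#) - sum f ≈⟨ +-congʳ (sum-replicate-zero n) ⟩
    0# - sum f                 ∎))

  +≈0⇒≈0 : ∀ {x y} → 0# ≤ x → 0# ≤ y → x + y ≈ 0# → x ≈ 0#
  +≈0⇒≈0 {x} {y} 0≤x 0≤y x+y≈0 = ≤-antisym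
    (0≤⇒≤ 0≤y (eq₁ x+y≈0 (solve 2 (λ x y → con (+ 0) :- x :- y := :- con (+ 1) :* (x :+ y :- con (+ 0)))
        refl x y)))
    0≤x

  sum≈0⇒≈0 : ∀ {n} {f : Vector Carrier n} → (∀ i → 0# ≤ f i) → sum f ≈ 0# → ∀ i → f i ≈ 0#
  sum≈0⇒≈0 0≤f ∑≈0 Fin.zero    = +≈0⇒≈0 (0≤f Fin.zero) (0≤sum (0≤f ∘ Fin.suc)) ∑≈0
  sum≈0⇒≈0 0≤f ∑≈0 (Fin.suc i) = sum≈0⇒≈0 (0≤f ∘ Fin.suc)
    (+≈0⇒≈0 (0≤sum (0≤f ∘ Fin.suc)) (0≤f Fin.zero) (trans (+-comm _ _) ∑≈0)) i

  sum-single : ∀ {n} {f : Vector Carrier n} j → (∀ i → ¬ i ≡ j → f i ≈ 0#) → sum f ≈ f j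
  sum-single {ℕ.suc n} Fin.zero    f≈0 =
    trans (+-congˡ (trans (sum-cong (λ i → f≈0 (Fin.suc i) λ ())) (sum-replicate-zero n))) (+-identityʳ _)
  sum-single {ℕ.suc n} (Fin.suc j) f≈0 =
    trans (+-cong (f≈0 Fin.zero λ ()) (sum-single j (λ i i≢j → f≈0 (Fin.suc i) (i≢j ∘ Fin.suc-injective))))
        (+-identityˡ _)

  -- Partial sums, started at c, and summation by parts

  scan : ∀ {n} → Carrier → Vector Carrier n → Vector Carrier n
  scan c f Fin.zero    = c + f Fin.zero
  scan c f (Fin.suc i) = scan (c + f Fin.zero) (f ∘ Fin.suc) i

  scan-cong : ∀ {n c c′} {f g : Vector Carrier n} → c ≈ c′ →
      (∀ i → f i ≈ g i) → ∀ i → scan c f i ≈ scan c′ g i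
  scan-cong c≈ f≈g Fin.zero    = +-cong c≈ (f≈g Fin.zero)
  scan-cong c≈ f≈g (Fin.suc i) = scan-cong (+-cong c≈ (f≈g Fin.zero)) (f≈g ∘ Fin.suc) i

  scan-step : ∀ {n} c (f : Vector Carrier (ℕ.suc n)) i → scan c f (Fin.suc i) ≈ scan c f (inject₁ i) + f
      (Fin.suc i)
  scan-step c f Fin.zero    = refl
  scan-step c f (Fin.suc i) = scan-step (c + f Fin.zero) (f ∘ Fin.suc) i

  -- The starting value `c` is arbitrary so that the induction hypothesis applies to the tail,
  -- started at `c + f₀`.
  summation-by-parts : ∀ {n} c (f r : Vector Carrier (ℕ.suc n)) →
    r Fin.zero * c + sum (λ i → r i * f i)
      ≈ r (Fin.fromℕ n) * scan c f (Fin.fromℕ n)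
        + sum (λ i → scan c f (inject₁ i) * (r (inject₁ i) - r (Fin.suc i)))
  summation-by-parts {ℕ.zero} c f r =
    solve 3 (λ r c f → r :* c :+ (r :* f :+ con (+ 0)) := r :* (c :+ f) :+ con (+ 0)) refl _ _ _
  summation-by-parts {ℕ.suc n} c f r = begin
    r₀ * c + (r₀ * f₀ + ∑rf)
      ≈⟨ solve 5 (λ r₀ r₁ c f₀ S → r₀ :* c :+ (r₀ :* f₀ :+ S)
           := (c :+ f₀) :* (r₀ :- r₁) :+ (r₁ :* (c :+ f₀) :+ S))
           refl r₀ r₁ c f₀ ∑rf ⟩
    (c + f₀) * (r₀ - r₁) + (r₁ * (c + f₀) + ∑rf)
      ≈⟨ +-congˡ (summation-by-parts (c + f₀) (f ∘ Fin.suc) (r ∘ Fin.suc)) ⟩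
    (c + f₀) * (r₀ - r₁) + (last + ∑S)
      ≈⟨ solve 3 (λ a b c → a :+ (b :+ c) := b :+ (a :+ c)) refl _ _ _ ⟩
    last + ((c + f₀) * (r₀ - r₁) + ∑S)  ∎
    where
    r₀ = r Fin.zero
    r₁ = r (Fin.suc Fin.zero)
    f₀ = f Fin.zero
    ∑rf = sum (λ i → r (Fin.suc i) * f (Fin.suc i))
    last = r (Fin.fromℕ (ℕ.suc n)) * scan c f (Fin.fromℕ (ℕ.suc n))
    ∑S = sum (λ i → scan (c + f₀) (f ∘ Fin.suc) (inject₁ i) * (r (inject₁ (Fin.suc i)) - r (Fin.suc
        (Fin.suc i))))

  -- Prefixes of a vector

  -- Entry `m` itself is kept, so entry 0 always survives.
  truncate : ∀ {n} → Fin n → Vector Carrier n → Vector Carrier n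
  truncate m           f Fin.zero    = f Fin.zero
  truncate Fin.zero    f (Fin.suc i) = 0#
  truncate (Fin.suc m) f (Fin.suc i) = truncate m (f ∘ Fin.suc) i

  sum-truncate : ∀ {n} m c (f g : Vector Carrier n) →
    c + sum (λ i → truncate m f i * g i) ≈ scan c (λ i → f i * g i) m
  sum-truncate {ℕ.suc n} Fin.zero    c f g = +-congˡ (begin
    f Fin.zero * g Fin.zero + sum (λ i → 0# * g (Fin.suc i))
      ≈⟨ +-congˡ (sum-cong (λ i → zeroˡ (g (Fin.suc i)))) ⟩
    f Fin.zero * g Fin.zero + sum {n} (λ _ → 0#)              ≈⟨ +-congˡ (sum-replicate-zero n) ⟩
    f Fin.zero * g Fin.zero + 0#                              ≈⟨ +-identityʳ _ ⟩
    f Fin.zero * g Fin.zero                                   ∎)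
  sum-truncate (Fin.suc m) c f g = trans (sym (+-assoc _ _ _))
    (sum-truncate m (c + f Fin.zero * g Fin.zero) (f ∘ Fin.suc) (g ∘ Fin.suc))

  0≤truncate : ∀ {n} {f : Vector Carrier n} → (∀ i → 0# ≤ f i) → ∀ m i → 0# ≤ truncate m f i
  0≤truncate 0≤f m           Fin.zero    = 0≤f Fin.zero
  0≤truncate 0≤f Fin.zero    (Fin.suc i) = ≤-reflexive refl
  0≤truncate 0≤f (Fin.suc m) (Fin.suc i) = 0≤truncate (0≤f ∘ Fin.suc) m i

  -- Away from the cut, two neighbouring entries are either both kept or both replaced by 0, so
  -- cross-multiplying with `f` gives an equality.
  truncate-edge : ∀ {n} (f : Vector Carrier (ℕ.suc n)) m j → ¬ m ≡ inject₁ j →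
    truncate m f (inject₁ j) * f (Fin.suc j) ≈ truncate m f (Fin.suc j) * f (inject₁ j)
  truncate-edge f Fin.zero    Fin.zero    m≢j = contradiction ≡.refl m≢j
  truncate-edge f Fin.zero    (Fin.suc j) m≢j = trans (zeroˡ _) (sym (zeroˡ _))
  truncate-edge f (Fin.suc m) Fin.zero    m≢j = *-comm _ _
  truncate-edge f (Fin.suc m) (Fin.suc j) m≢j = truncate-edge (f ∘ Fin.suc) m j (m≢j ∘ ≡.cong Fin.suc)

  -- Only the cut is left open by `truncate-edge`; there the truncated entry on the left is 0 and
  -- the product on the right is nonnegative.
  truncate-descends : ∀ {n} {f : Vector Carrier (ℕ.suc n)} → (∀ i → 0# ≤ f i) → ∀ m j →
    truncate m f (Fin.suc j) * f (inject₁ j) ≤ truncate m f (inject₁ j) * f (Fin.suc j)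
  truncate-descends {f = f} 0≤f m j with m Fin.≟ inject₁ j
  ... | no m≢j = ≤-reflexive (sym (truncate-edge f m j m≢j))
  ... | yes ≡.refl = ≤-resp₂-≈ (sym (trans (*-congʳ (beyond j)) (zeroˡ _))) refl
        (0≤* (0≤truncate 0≤f (inject₁ j) (inject₁ j)) (0≤f (Fin.suc j)))
    where
    beyond : ∀ {n} {f : Vector Carrier (ℕ.suc n)} j → truncate (inject₁ j) f (Fin.suc j) ≈ 0#
    beyond Fin.zero    = refl
    beyond {f = f} (Fin.suc j) = beyond {f = f ∘ Fin.suc} j

  -- The integer-valued Kronecker delta

  δ : ∀ {n} → Fin n → Fin n → ℤ
  δ Fin.zero    Fin.zero    = + 1
  δ Fin.zero    (Fin.suc j) = + 0
  δ (Fin.suc i) Fin.zero    = + 0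
  δ (Fin.suc i) (Fin.suc j) = δ i j

  δ-refl : ∀ {n} (i : Fin n) → δ i i ≡ + 1
  δ-refl Fin.zero    = ≡.refl
  δ-refl (Fin.suc i) = δ-refl i

  δ-≢ : ∀ {n} {i j : Fin n} → ¬ i ≡ j → δ i j ≡ + 0
  δ-≢ {i = Fin.zero}  {Fin.zero}  i≢j = contradiction ≡.refl i≢j
  δ-≢ {i = Fin.zero}  {Fin.suc j} i≢j = ≡.refl
  δ-≢ {i = Fin.suc i} {Fin.zero}  i≢j = ≡.refl
  δ-≢ {i = Fin.suc i} {Fin.suc j} i≢j = δ-≢ (i≢j ∘ ≡.cong Fin.suc)

  δ-sym : ∀ {n} (i j : Fin n) → δ i j ≡ δ j i
  δ-sym Fin.zero    Fin.zero    = ≡.refl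
  δ-sym Fin.zero    (Fin.suc j) = ≡.refl
  δ-sym (Fin.suc i) Fin.zero    = ≡.refl
  δ-sym (Fin.suc i) (Fin.suc j) = δ-sym i j

  sum-δ : ∀ {n} (g : Vector Carrier n) j → sum (λ i → g i * fromℤ (δ i j)) ≈ g j
  sum-δ g j = trans
    (sum-single j (λ i i≢j → trans (*-congˡ (reflexive (≡.cong fromℤ (δ-≢ i≢j)))) (zeroʳ (g i))))
    (trans (*-congˡ (trans (reflexive (≡.cong fromℤ (δ-refl j))) (+-identityʳ 1#))) (*-identityʳ (g j)))


-- Linked lists as families of inequalities, and bounds for finite vectors

module _ {a r} {A : Set a} {R : Rel A r} where

  -- The list has the shape used by `lectureHall`: its leading 0 becomes entry 0 of `f`, its closing
  -- 1 becomes `b`.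
  linked⇒steps : ∀ {n} (f : Vector A (ℕ.suc n)) {b} →
    Linked R (f Fin.zero List.∷ toList (f ∘ Fin.suc) List.++ List.[ b ]) →
    (∀ i → R (f (inject₁ i)) (f (Fin.suc i))) × R (f (Fin.fromℕ n)) b
  linked⇒steps {ℕ.zero}  f (Rab Linked.∷ _) = (λ ()) , Rab
  linked⇒steps {ℕ.suc n} f (R₀₁ Linked.∷ l) with linked⇒steps (f ∘ Fin.suc) l
  ... | steps , last = (λ { Fin.zero → R₀₁ ; (Fin.suc i) → steps i }) , last

  steps⇒linked : ∀ {n} (f : Vector A (ℕ.suc n)) {b} →
    (∀ i → R (f (inject₁ i)) (f (Fin.suc i))) → R (f (Fin.fromℕ n)) b →
    Linked R (f Fin.zero List.∷ toList (f ∘ Fin.suc) List.++ List.[ b ])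
  steps⇒linked {ℕ.zero}  f steps last = last Linked.∷ [-]
  steps⇒linked {ℕ.suc n} f steps last =
    steps Fin.zero Linked.∷ steps⇒linked (f ∘ Fin.suc) (steps ∘ Fin.suc) last

bounded : ∀ {n} (f : Vector ℕ n) → ∃[ N ] (∀ i → f i ℕ.≤ N)
bounded {ℕ.zero}  f = 0 , λ ()
bounded {ℕ.suc n} f with bounded (f ∘ Fin.suc)
... | N , f≤N = f Fin.zero ℕ.+ N , λ
  { Fin.zero    → ℕ.m≤m+n (f Fin.zero) N
  ; (Fin.suc i) → ℕ.≤-trans (f≤N i) (ℕ.m≤n+m N (f Fin.zero))
  }

-- Facet inequalities of the lecture hall polytope without denominators

module LectureHall {ℓ} (ℝ : Reals ℓ) {d} (s : Vector ℕ d) (s≢0 : ∀ i → NonZero (s i)) where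

  open Reals ℝ
  open Polytopes ℝ
  open RealProperties ℝ
  open Solver using (solve; _:=_; _:+_; _:*_; _:-_; :-_; con)
  open SetoidReasoning setoid

  s₀∷≢0 : ∀ i → NonZero (s₀∷ s i)
  s₀∷≢0 Fin.zero    = _
  s₀∷≢0 (Fin.suc i) = s≢0 i

  σ ρ : Vector Carrier (ℕ.suc d)
  σ i = fromℕ (s₀∷ s i)
  ρ i = recip (s₀∷ s i) {{s₀∷≢0 i}}

  0<σ : ∀ i → 0# < σ i
  0<σ i = 0<fromℕ (s₀∷ s i) {{s₀∷≢0 i}}

  0<ρ : ∀ i → 0# < ρ i
  0<ρ i = 0<recip (s₀∷ s i) {{s₀∷≢0 i}}

  σ*ρ : ∀ i → σ i * ρ i ≈ 1#
  σ*ρ i = *-recip (s₀∷ s i) {{s₀∷≢0 i}}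

  -- Used for `0# ∷ x`. As s₀ = 1, the inequality at index 0 is then 0 ≤ x₁, so that all facets but
  -- the last have one common form.
  Chain : Vector Carrier (ℕ.suc d) → Set ℓ
  Chain X = (∀ i → X (inject₁ i) * σ (Fin.suc i) ≤ X (Fin.suc i) * σ (inject₁ i))
          × X (Fin.fromℕ d) ≤ σ (Fin.fromℕ d)

  ratios : ∀ (x : Point d) i → (0# ∷ (λ i → (x i / s i) {{s≢0 i}})) i ≈ (0# ∷ x) i * ρ i
  ratios x Fin.zero    = sym (zeroˡ _)
  ratios x (Fin.suc i) = refl

  lectureHall⇒chain : ∀ {x} → x ∈ lectureHall s s≢0 → Chain (0# ∷ x)
  lectureHall⇒chain {x} x∈P with linked⇒steps (0# ∷ (λ i → (x i / s i) {{s≢0 i}})) x∈P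
  ... | steps , last =
      (λ i → let i₀ = inject₁ i ; i₁ = Fin.suc i in 0≤⇒≤
        (0≤* (0≤* (<⇒≤ (0<σ i₀)) (<⇒≤ (0<σ i₁)))
          (≤⇒0≤ (≤-resp₂-≈ (ratios x i₀) (ratios x i₁) (steps i))))
        (eq₂ (σ*ρ i₀) (σ*ρ i₁)
          (solve 6 (λ X X′ σ ρ σ′ ρ′ →
              X′ :* σ :- X :* σ′ :- σ :* σ′ :* (X′ :* ρ′ :- X :* ρ)
                := (X :* σ′) :* (σ :* ρ :- con (+ 1)) :+ (:- X′ :* σ) :* (σ′ :* ρ′ :- con (+ 1)))
            refl ((0# ∷ x) i₀) ((0# ∷ x) i₁) (σ i₀) (ρ i₀) (σ i₁) (ρ i₁))))
    , 0≤⇒≤ (0≤* (<⇒≤ (0<σ (Fin.fromℕ d))) (≤⇒0≤ (≤-resp₂-≈ (ratios x (Fin.fromℕ d)) refl last)))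
        (eq₁ (σ*ρ (Fin.fromℕ d))
          (solve 3 (λ X σ ρ → σ :- X :- σ :* (con (+ 1) :- X :* ρ) := X :* (σ :* ρ :- con (+ 1)))
            refl _ (σ (Fin.fromℕ d)) (ρ (Fin.fromℕ d))))

  chain⇒lectureHall : ∀ {x} → Chain (0# ∷ x) → x ∈ lectureHall s s≢0
  chain⇒lectureHall {x} (steps , last) = steps⇒linked (0# ∷ (λ i → (x i / s i) {{s≢0 i}}))
    (λ i → let i₀ = inject₁ i ; i₁ = Fin.suc i in
      ≤-resp₂-≈ (sym (ratios x i₀)) (sym (ratios x i₁)) (0≤⇒≤
        (0≤* (0≤* (<⇒≤ (0<ρ i₀)) (<⇒≤ (0<ρ i₁))) (≤⇒0≤ (steps i)))
        (eq₂ (σ*ρ i₀) (σ*ρ i₁)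
          (solve 6 (λ X X′ σ ρ σ′ ρ′ →
              X′ :* ρ′ :- X :* ρ :- ρ :* ρ′ :* (X′ :* σ :- X :* σ′)
                := (:- X′ :* ρ′) :* (σ :* ρ :- con (+ 1)) :+ (X :* ρ) :* (σ′ :* ρ′ :- con (+ 1)))
            refl ((0# ∷ x) i₀) ((0# ∷ x) i₁) (σ i₀) (ρ i₀) (σ i₁) (ρ i₁)))))
    (≤-resp₂-≈ (sym (ratios x (Fin.fromℕ d))) refl (0≤⇒≤
      (0≤* (<⇒≤ (0<ρ (Fin.fromℕ d))) (≤⇒0≤ last))
      (eq₁ (σ*ρ (Fin.fromℕ d))
        (solve 3 (λ X σ ρ → con (+ 1) :- X :* ρ :- ρ :* (σ :- X) := (:- con (+ 1)) :* (σ :* ρ :- con (+ 1)))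
          refl _ (σ (Fin.fromℕ d)) (ρ (Fin.fromℕ d))))))

  -- Downward induction from the last facet: Xᵢ / sᵢ is at most the next ratio, which is at most 1.
  chain⇒≤σ : ∀ {X} → Chain X → ∀ i → X i ≤ σ i
  chain⇒≤σ {X} (steps , last) = >-weakInduction (λ i → X i ≤ σ i) last
    (λ i X′≤σ′ → 0<⇒*-cancelˡ-≤ (0<σ (Fin.suc i)) (≤-resp₂-≈ (*-comm _ _) (*-comm _ _)
      (≤-trans (steps i) (0≤⇒≤ (0≤* (≤⇒0≤ X′≤σ′) (<⇒≤ (0<σ (inject₁ i))))
        (solve 3 (λ X σ σ′ → σ :* σ′ :- X :* σ := (σ′ :- X) :* σ) refl _ _ _)))))

  -- Chain after the lattice point s - 1 has been moved to the origin.
  Centred : Vector Carrier (ℕ.suc d) → Set ℓ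
  Centred U = (∀ i → U (inject₁ i) * σ (Fin.suc i)
                       ≤ U (Fin.suc i) * σ (inject₁ i) + (σ (Fin.suc i) - σ (inject₁ i)))
            × U (Fin.fromℕ d) ≤ 1#

  chain⇒centred : ∀ {X U} → (∀ i → X i ≈ U i + (σ i - 1#)) → Chain X → Centred U
  chain⇒centred {X} {U} X≈ (steps , last) =
      (λ i → 0≤⇒≤ (≤⇒0≤ (≤-resp₂-≈ (*-congʳ (X≈ (inject₁ i))) (*-congʳ (X≈ (Fin.suc i))) (steps i)))
        (solve 4 (λ U U′ σ σ′ → U′ :* σ :+ (σ′ :- σ) :- U :* σ′
            := (U′ :+ (σ′ :- con (+ 1))) :* σ :- (U :+ (σ :- con (+ 1))) :* σ′) refl _ _ _ _))
    , 0≤⇒≤ (≤⇒0≤ (≤-resp₂-≈ (X≈ _) refl last))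
        (solve 2 (λ U σ → con (+ 1) :- U := σ :- (U :+ (σ :- con (+ 1)))) refl _ _)

  centred⇒chain : ∀ {X U} → (∀ i → X i ≈ U i + (σ i - 1#)) → Centred U → Chain X
  centred⇒chain {X} {U} X≈ (steps , last) =
      (λ i → ≤-resp₂-≈ (*-congʳ (sym (X≈ (inject₁ i)))) (*-congʳ (sym (X≈ (Fin.suc i)))) (0≤⇒≤ (≤⇒0≤
          (steps i))
        (solve 4 (λ U U′ σ σ′ → (U′ :+ (σ′ :- con (+ 1))) :* σ :- (U :+ (σ :- con (+ 1))) :* σ′
            := U′ :* σ :+ (σ′ :- σ) :- U :* σ′) refl _ _ _ _)))
    , ≤-resp₂-≈ (sym (X≈ _)) refl (0≤⇒≤ (≤⇒0≤ last)
        (solve 2 (λ U σ → σ :- (U :+ (σ :- con (+ 1))) := con (+ 1) :- U) refl _ _))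

-- Convex hulls and duals

module DualProperties {ℓ} (ℝ : Reals ℓ) where

  open Reals ℝ
  open Polytopes ℝ
  open RealProperties ℝ
  open Solver using (solve; _:=_; _:+_; _:*_; _:-_; :-_; con)
  open SetoidReasoning setoid

  -- The slack `1# - ⟨ x , y ⟩` is affine in `y`, and affine functions commute with combinations
  -- whose weights sum to 1.
  slack-combination : ∀ {n d} (x : Point d) {y} (a : Vector Carrier n) p → sum a ≈ 1# → y ≋ combination a p →
    1# - ⟨ x , y ⟩ ≈ sum (λ i → a i * (1# - ⟨ x , p i ⟩))
  slack-combination x {y} a p ∑a y≋ = sym (begin
    sum (λ i → a i * (1# - ⟨ x , p i ⟩))
      ≈⟨ sum-cong (λ i → solve 2 (λ a p → a :* (con (+ 1) :- p) := a :- a :* p) refl (a i) ⟨ x , p i ⟩) ⟩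
    sum (λ i → a i - a i * ⟨ x , p i ⟩)              ≈⟨ sum-minus a (λ i → a i * ⟨ x , p i ⟩) ⟩
    sum a - sum (λ i → a i * ⟨ x , p i ⟩)            ≈⟨ +-cong ∑a (-‿cong (begin
      sum (λ i → a i * ⟨ x , p i ⟩)
        ≈⟨ sum-cong (λ i → *-distribˡ-sum (a i) (λ j → x j * p i j)) ⟩
      sum (λ i → sum (λ j → a i * (x j * p i j)))    ≈⟨ ∑-comm (λ i j → a i * (x j * p i j)) ⟩
      sum (λ j → sum (λ i → a i * (x j * p i j)))    ≈⟨ sum-cong (λ j → begin
        sum (λ i → a i * (x j * p i j))
          ≈⟨ sum-cong (λ i → solve 3 (λ a x p → a :* (x :* p) := x :* (a :* p)) refl (a i) (x j) (p i j)) ⟩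
        sum (λ i → x j * (a i * p i j))              ≈⟨ *-distribˡ-sum (x j) (λ i → a i * p i j) ⟨
        x j * combination a p j                      ≈⟨ *-congˡ (y≋ j) ⟨
        x j * y j                                    ∎) ⟩
      ⟨ x , y ⟩                                      ∎)) ⟩
    1# - ⟨ x , y ⟩                                   ∎)

  convexHull⊆dual : ∀ {n d} {P : Region d} {p : Vector (Point d) n} → (∀ i → p i ∈ dual P) →
    ∀ {y} → y ∈ convexHull p → y ∈ dual P
  convexHull⊆dual {p = p} p∈ (a , 0≤a , ∑a , y≋) x x∈P =
    0≤⇒≤ (0≤sum (λ i → 0≤* (0≤a i) (≤⇒0≤ (p∈ i x x∈P)))) (slack-combination x a p ∑a y≋)

  vertex∈convexHull : ∀ {n d} (p : Vector (Point d) n) k → p k ∈ convexHull p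
  vertex∈convexHull p k =
      (λ i → fromℤ (δ i k)) , (λ i → fromℤ-mono-≤ (0≤δ i k))
    , trans (sum-cong (λ i → sym (*-identityˡ (fromℤ (δ i k))))) (sum-δ (λ _ → 1#) k)
    , λ j → sym (trans (sum-cong (λ i → *-comm _ (p i j))) (sum-δ (λ i → p i j) k))
    where
    0≤δ : ∀ {n} (i j : Fin n) → + 0 ℤ.≤ δ i j
    0≤δ i j with i Fin.≟ j
    ... | yes ≡.refl = ℤ.≤-trans (ℤ.+≤+ ℕ.z≤n) (ℤ.≤-reflexive (≡.sym (δ-refl i)))
    ... | no i≢j     = ℤ.≤-reflexive (≡.sym (δ-≢ i≢j))

-- The Fano translate: its translation vector and its facets

module FanoTranslate {ℓ} (ℝ : Reals ℓ) {d} (s : Vector ℕ (ℕ.suc d)) (s≢0 : ∀ i → NonZero (s i))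
  (s-increasing : s Preserves Fin._<_ ⟶ ℕ._<_)
  (Q : Polytopes.Region ℝ (ℕ.suc d)) (Q-isFano : Polytopes.IsFano ℝ Q)
  (P∼Q : Polytopes.TranslationEquivalent ℝ (Polytopes.lectureHall ℝ s s≢0) Q)
  where

  open Reals ℝ
  open Polytopes ℝ
  open RealProperties ℝ
  open LectureHall ℝ s s≢0
  open Solver using (solve; _:=_; _:+_; _:*_; _:-_; :-_; con)
  open SetoidReasoning setoid
  open IsFano Q-isFano

  private
    t = proj₁ P∼Q

  -- An arbitrary `Region` need not respect `_≋_`, but a convex hull does, since its points are only
  -- required to match a combination up to `_≋_`.
  Q-resp-≋ : ∀ {u u′} → u ≋ u′ → u ∈ Q → u′ ∈ Q
  Q-resp-≋ u≋u′ u∈Q with isLatticePolytope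
  ... | _ , _ , Q⊆ , ⊆Q with Q⊆ u∈Q
  ...   | a , 0≤a , ∑a , u≋ = ⊆Q (a , 0≤a , ∑a , λ i → trans (sym (u≋u′ i)) (u≋ i))

  shift : Point (ℕ.suc d) → Point (ℕ.suc d)
  shift u i = u i + fromℤ (t i)

  unshift : ∀ u → u ≋ (λ i → shift u i - fromℤ (t i))
  unshift u i = solve 2 (λ u t → u := u :+ t :- t) refl _ _

  Q⇒chain : ∀ {u} → u ∈ Q → Chain (0# ∷ shift u)
  Q⇒chain {u} u∈Q = lectureHall⇒chain (proj₂ (proj₂ P∼Q) (Q-resp-≋ (unshift u) u∈Q))

  chain⇒Q : ∀ {u} → Chain (0# ∷ shift u) → u ∈ Q
  chain⇒Q {u} X = Q-resp-≋ (λ i → sym (unshift u i)) (proj₁ (proj₂ P∼Q) (chain⇒lectureHall X))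

  -- Makes k₀ positive. A ball around the origin lies in `Q`, so it contains the points with all
  -- coordinates η or all -η. Their translates satisfy the facet inequalities, which forces 0 < t₁ <
  -- s₁ for the integer t₁.
  1<s₁ : 1 ℕ.< s Fin.zero
  1<s₁ with Equivalence.from (interiorLattice (λ _ → + 0)) (λ _ → ≡.refl)
  ... | ε , 0<ε , ball = ℤ.drop‿+<+ (ℤ.≤-<-trans 1≤t (fromℤ-cancel-< t<s))
    where
    η = recip 2 * ε

    0<η : 0# < η
    0<η = *-pos (0<recip 2) 0<ε

    η<ε : η < ε
    η<ε = 0<⇒< 0<η (eq₁ (*-recip 2)
      (solve 2 (λ h ε → ε :- h :* ε :- h :* ε
          := (:- ε) :* ((con (+ 1) :+ (con (+ 1) :+ con (+ 0))) :* h :- con (+ 1))) refl (recip 2) ε))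

    η∈Q : (λ _ → η) ∈ Q
    η∈Q = ball _ (λ _ → 0<⇒< (0<+ 0<η 0<ε) (solve 1 (λ x → x :- con (+ 0) := x) refl _)
                      , <-respʳ-≈ (sym (+-identityˡ ε)) η<ε)

    -η∈Q : (λ _ → - η) ∈ Q
    -η∈Q = ball _ (λ _ → 0<⇒< (<⇒0< η<ε) (solve 2 (λ η ε → :- η :+ ε :- con (+ 0) := ε :- η) refl η ε)
                       , 0<⇒< (0<+ 0<η 0<ε) (solve 2 (λ η ε → con (+ 0) :+ ε :- :- η := η :+ ε) refl η ε))

    t<s : fromℤ (t Fin.zero) < fromℤ (+ s Fin.zero)
    t<s = <-≤-trans (0<⇒< 0<η (solve 2 (λ η t → η :+ t :- t := η) refl η _))
      (chain⇒≤σ {0# ∷ shift (λ _ → η)} (Q⇒chain η∈Q) (Fin.suc Fin.zero))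

    0<t : fromℤ (+ 0) < fromℤ (t Fin.zero)
    0<t = <-≤-trans 0<η (0≤⇒≤ (≤⇒0≤ (proj₁ (Q⇒chain -η∈Q) Fin.zero))
      (solve 3 (λ η t σ′ → t :- η := (:- η :+ t) :* (con (+ 1) :+ con (+ 0)) :- con (+ 0) :* σ′)
          refl η _ (σ (Fin.suc Fin.zero))))

    1≤t : + 1 ℤ.≤ t Fin.zero
    1≤t = ℤ.i<j⇒suc[i]≤j (fromℤ-cancel-< {+ 0} 0<t)

  s₀∷-increasing : ∀ i → s₀∷ s (inject₁ i) ℕ.< s₀∷ s (Fin.suc i)
  s₀∷-increasing Fin.zero    = 1<s₁
  s₀∷-increasing (Fin.suc i) = s-increasing (ℕ.s≤s (ℕ.≤-reflexive (Fin.toℕ-inject₁ i)))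

  κ : Vector Carrier (ℕ.suc d)
  κ i = fromℕ (gap s i)

  κ≈ : ∀ i → κ i ≈ σ (Fin.suc i) - σ (inject₁ i)
  κ≈ i = fromℕ-∸ (ℕ.<⇒≤ (s₀∷-increasing i))

  gap≢0 : ∀ i → NonZero (gap s i)
  gap≢0 i = ℕ.>-nonZero (ℕ.m<n⇒0<n∸m (s₀∷-increasing i))

  0<κ : ∀ i → 0# < κ i
  0<κ i = 0<fromℕ (gap s i) {{gap≢0 i}}

  1≤κ : ∀ i → 1# ≤ κ i
  1≤κ i = ≤-resp₂-≈ (+-identityʳ 1#) refl
    (fromℤ-mono-≤ {+ 1} {+ gap s i} (ℤ.+≤+ (ℕ.m<n⇒0<n∸m (s₀∷-increasing i))))

  fromℤ-s-1 : ∀ i → fromℤ (+ s i ℤ.- + 1) ≈ σ (Fin.suc i) - 1#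
  fromℤ-s-1 i = trans (fromℤ-minus (+ s i) (+ 1)) (+-congˡ (-‿cong (+-identityʳ 1#)))

  -- The point s - 1 is interior to the lecture hall polytope, so its translate `z` is an interior
  -- lattice point of `Q` and must be the origin.
  t≡s-1 : ∀ i → + s i ℤ.- + 1 ≡ t i
  t≡s-1 i = ℤ.i-j≡0⇒i≡j _ _ (Equivalence.to (interiorLattice z)
      (ε , 0<recip (ℕ.suc N) , λ y near → chain⇒Q (chain y near)) i)
    where
    z : Vector ℤ (ℕ.suc d)
    z i = + s i ℤ.- + 1 ℤ.- t i

    fromℤ-z : ∀ i → fromℤ (z i) ≈ σ (Fin.suc i) - 1# - fromℤ (t i)
    fromℤ-z i = trans (fromℤ-minus (+ s i ℤ.- + 1) (t i)) (+-congʳ (fromℤ-s-1 i))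

    -- At s - 1 the cross-multiplied inequality i has slack kᵢ ≥ 1. Moving every coordinate by at
    -- most ε costs at most ε (sᵢ + sᵢ₊₁), so ε = 1 / (N + 1) with `N` bounding these sums is small
    -- enough.
    s+s-bounded = bounded (λ i → s₀∷ s (inject₁ i) ℕ.+ s₀∷ s (Fin.suc i))

    N = proj₁ s+s-bounded

    ε = recip (ℕ.suc N)

    ν = fromℕ (ℕ.suc N)

    σ+σ≤ν : ∀ i → σ (inject₁ i) + σ (Fin.suc i) ≤ ν
    σ+σ≤ν i = ≤-resp₂-≈ (fromℤ-+ (+ s₀∷ s (inject₁ i)) (+ s₀∷ s (Fin.suc i))) refl
      (fromℤ-mono-≤ {j = + ℕ.suc N} (ℤ.+≤+ (ℕ.m≤n⇒m≤1+n (proj₂ s+s-bounded i))))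

    1≤ν : 1# ≤ ν
    1≤ν = ≤-resp₂-≈ (+-identityʳ 1#) refl (fromℤ-mono-≤ {+ 1} {+ ℕ.suc N} (ℤ.+≤+ (ℕ.s≤s ℕ.z≤n)))

    module _ (y : Point (ℕ.suc d)) (near : ∀ i → lattice z i < y i + ε × y i < lattice z i + ε) where

      X = 0# ∷ shift y

      lower : ∀ i → σ i - 1# ≤ X i + ε
      lower Fin.zero    = 0≤⇒≤ (<⇒≤ (0<recip (ℕ.suc N)))
        (solve 1 (λ ε → con (+ 0) :+ ε :- ((con (+ 1) :+ con (+ 0)) :- con (+ 1)) := ε) refl ε)
      lower (Fin.suc i) = 0≤⇒≤ (≤⇒0≤ (≤-resp₂-≈ (fromℤ-z i) refl (<⇒≤ (proj₁ (near i)))))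
        (solve 4 (λ y t ε σ → y :+ t :+ ε :- (σ :- con (+ 1)) := y :+ ε :- (σ :- con (+ 1) :- t))
            refl _ _ _ _)

      upper : ∀ i → X i ≤ σ i - 1# + ε
      upper Fin.zero    = 0≤⇒≤ (<⇒≤ (0<recip (ℕ.suc N)))
        (solve 1 (λ ε → (con (+ 1) :+ con (+ 0)) :- con (+ 1) :+ ε :- con (+ 0) := ε) refl ε)
      upper (Fin.suc i) = 0≤⇒≤ (≤⇒0≤ (≤-respʳ-≈ (+-congʳ (fromℤ-z i)) (<⇒≤ (proj₂ (near i)))))
        (solve 4 (λ y t ε σ → σ :- con (+ 1) :+ ε :- (y :+ t) := σ :- con (+ 1) :- t :+ ε :- y) refl _ _ _ _)

      chain : Chain X
      chain = (λ i → let i₀ = inject₁ i ; i₁ = Fin.suc i in 0≤⇒≤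
            -- The terms are the two coordinate bounds scaled by sᵢ and sᵢ₊₁, then kᵢ - 1, then ε (ν
            -- - sᵢ - sᵢ₊₁); they add up to the required difference because ν ε = 1.
            (0≤+ (0≤+ (0≤* (<⇒≤ (0<σ i₀)) (≤⇒0≤ (lower i₁))) (0≤* (<⇒≤ (0<σ i₁)) (≤⇒0≤ (upper i₀))))
                 (0≤+ (≤⇒0≤ (≤-respʳ-≈ (κ≈ i) (1≤κ i))) (0≤* (<⇒≤ (0<recip (ℕ.suc N))) (≤⇒0≤ (σ+σ≤ν i)))))
            (eq₁ (*-recip (ℕ.suc N)) (solve 6 (λ X X′ σ σ′ ε ν →
                X′ :* σ :- X :* σ′ :- (σ :* (X′ :+ ε :- (σ′ :- con (+ 1))) :+ σ′ :* (σ :- con (+ 1) :+ ε :- X)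
                    :+ (σ′ :- σ :- con (+ 1) :+ ε :* (ν :- (σ :+ σ′))))
                  := (:- con (+ 1)) :* (ν :* ε :- con (+ 1)))
              refl (X i₀) (X i₁) (σ i₀) (σ i₁) ε ν)))
        , ≤-trans (upper (Fin.fromℕ _)) (0≤⇒≤
            (0≤* (<⇒≤ (0<recip (ℕ.suc N))) (≤⇒0≤ 1≤ν))
            (eq₁ (*-recip (ℕ.suc N)) (solve 3 (λ σ ε ν →
              σ :- (σ :- con (+ 1) :+ ε) :- ε :* (ν :- con (+ 1)) := (:- con (+ 1)) :* (ν :* ε :- con (+ 1)))
              refl (σ (Fin.fromℕ _)) ε ν)))

  -- The prepended 0 needs no correction, because s₀ - 1 = 0.
  centre : ∀ u i → (0# ∷ shift u) i ≈ (0# ∷ u) i + (σ i - 1#)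
  centre u Fin.zero    = solve 0 (con (+ 0) := con (+ 0) :+ ((con (+ 1) :+ con (+ 0)) :- con (+ 1))) refl
  centre u (Fin.suc i) = +-congˡ (begin
    fromℤ (t i)                      ≡⟨ ≡.cong fromℤ (t≡s-1 i) ⟨
    fromℤ (+ s i ℤ.- + 1)            ≈⟨ fromℤ-s-1 i ⟩
    σ (Fin.suc i) - 1#               ∎)

  Q⇒centred : ∀ {u} → u ∈ Q → Centred (0# ∷ u)
  Q⇒centred {u} u∈Q = chain⇒centred (centre u) (Q⇒chain u∈Q)

  centred⇒Q : ∀ {u} → Centred (0# ∷ u) → u ∈ Q
  centred⇒Q {u} U = chain⇒Q (centred⇒chain (centre u) U)

  -- Vertices of `Q`, and slacks as partial sums

  open DualProperties ℝ

  private
    D = ℕ.suc d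
    D# = Fin.fromℕ D

  homogenise : Point D → Vector Carrier (ℕ.suc D)
  homogenise y = (1# - sum y) ∷ y

  slack : Point D → Vector Carrier (ℕ.suc D)
  slack y = scan 0# (λ i → σ i * homogenise y i)

  -- Before s - 1 is subtracted, this is the vertex (0, ..., 0, sₘ₊₁, ..., s_d) of the lecture hall
  -- polytope, with m leading zeros.
  vertex : Fin (ℕ.suc D) → Point D
  vertex m i = 1# - truncate m σ (Fin.suc i)

  vertex₀ : ∀ m i → (0# ∷ vertex m) i ≈ 1# - truncate m σ i
  vertex₀ m Fin.zero    = solve 0 (con (+ 0) := con (+ 1) :- (con (+ 1) :+ con (+ 0))) refl
  vertex₀ m (Fin.suc i) = refl

  -- With T for the truncation of `σ`, facet i has slack Tᵢ sᵢ₊₁ - Tᵢ₊₁ sᵢ at the vertex, which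
  -- `truncate-descends` bounds below; the last facet has slack T_d.
  vertex∈Q : ∀ m → vertex m ∈ Q
  vertex∈Q m = centred⇒Q
    ( (λ i → ≤-resp₂-≈ (*-congʳ (sym (vertex₀ m (inject₁ i))))
        (+-congʳ (*-congʳ (sym (vertex₀ m (Fin.suc i)))))
        (0≤⇒≤ (≤⇒0≤ (truncate-descends {f = σ} (λ i → <⇒≤ (0<σ i)) m i))
          (solve 4 (λ T T′ σ σ′ → (con (+ 1) :- T′) :* σ :+ (σ′ :- σ) :- (con (+ 1) :- T) :* σ′
              := T :* σ′ :- T′ :* σ)
            refl _ _ (σ (inject₁ i)) (σ (Fin.suc i)))))
    , ≤-resp₂-≈ (sym (vertex₀ m D#)) refl
        (0≤⇒≤ (0≤truncate {f = σ} (λ i → <⇒≤ (0<σ i)) m D#)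
          (solve 1 (λ T → con (+ 1) :- (con (+ 1) :- T) := T) refl _)))

  -- The partial sum is a full sum against the truncation of `σ`. Its first term is s₀ Y₀ = 1 - Σ y,
  -- and Σ y merges with the remaining terms into the pairing with 1 - T.
  slack≈ : ∀ y m → slack y m ≈ 1# - ⟨ vertex m , y ⟩
  slack≈ y m = begin
    slack y m                                              ≈⟨ sum-truncate m 0# σ (homogenise y) ⟨
    0# + (σ Fin.zero * (1# - sum y) + ∑Ty)
      ≈⟨ solve 2 (λ Y T → con (+ 0) :+ ((con (+ 1) :+ con (+ 0)) :* (con (+ 1) :- Y) :+ T)
           := con (+ 1) :- (Y :- T)) refl (sum y) ∑Ty ⟩
    1# - (sum y - ∑Ty)
      ≈⟨ +-congˡ (-‿cong (sum-minus y (λ i → truncate m σ (Fin.suc i) * y i))) ⟨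
    1# - sum (λ i → y i - truncate m σ (Fin.suc i) * y i)
      ≈⟨ +-congˡ (-‿cong (sum-cong (λ i → solve 2 (λ y T → y :- T :* y := (con (+ 1) :- T) :* y)
           refl (y i) (truncate m σ (Fin.suc i))))) ⟩
    1# - ⟨ vertex m , y ⟩                                  ∎
    where ∑Ty = sum (λ i → truncate m σ (Fin.suc i) * y i)

  0≤slack : ∀ {y} → y ∈ dual Q → ∀ m → 0# ≤ slack y m
  0≤slack {y} y∈ m = ≤-respʳ-≈ (sym (slack≈ y m)) (≤⇒0≤ (y∈ (vertex m) (vertex∈Q m)))

  sum-homogenise : ∀ y → sum (homogenise y) ≈ 1#
  sum-homogenise y = solve 1 (λ Y → con (+ 1) :- Y :+ Y := con (+ 1)) refl (sum y)

  -- Summation by parts for gᵢ Yᵢ = (gᵢ / sᵢ) (sᵢ Yᵢ), where the partial sums of the second factor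
  -- are the slacks. Taking g = 1 yields the total weight 1, taking g to be a unit vector yields a
  -- coordinate of `y`.
  weighted-by-slack : ∀ y (g : Vector Carrier (ℕ.suc D)) →
    sum (λ i → g i * homogenise y i)
      ≈ ρ D# * g D# * slack y D#
        + sum (λ i → slack y (inject₁ i) * (ρ (inject₁ i) * g (inject₁ i) - ρ (Fin.suc i) * g (Fin.suc i)))
  weighted-by-slack y g = begin
    sum (λ i → g i * homogenise y i)
      ≈⟨ sum-cong (λ i → sym (eq₁ (σ*ρ i) (solve 4 (λ σ ρ g y →
           ρ :* g :* (σ :* y) :- g :* y := g :* y :* (σ :* ρ :- con (+ 1)))
               refl (σ i) (ρ i) (g i) (homogenise y i)))) ⟩
    ∑
      ≈⟨ solve 2 (λ r S → S := r :* con (+ 0) :+ S) refl (ρ Fin.zero * g Fin.zero) ∑ ⟩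
    ρ Fin.zero * g Fin.zero * 0# + ∑
      ≈⟨ summation-by-parts 0# (λ i → σ i * homogenise y i) (λ i → ρ i * g i) ⟩
    _ ∎
    where ∑ = sum (λ i → ρ i * g i * (σ i * homogenise y i))

  -- The vector b eⱼ - c eⱼ₊₁ with e₀ = 0. It is the dual vertex for b = sⱼ₊₁ / kⱼ and c = sⱼ / kⱼ;
  -- both are left open so that they can be real quotients in one direction and integral ones in the
  -- other.
  facet : Carrier → Carrier → Fin D → Point D
  facet b c j i = fromℤ (δ (inject₁ j) (Fin.suc i)) * b - fromℤ (δ (Fin.suc j) (Fin.suc i)) * c

  pair-δ : ∀ (u : Point D) k → sum (λ i → u i * fromℤ (δ k (Fin.suc i))) ≈ (0# ∷ u) k
  pair-δ u k = begin
    sum (λ i → u i * fromℤ (δ k (Fin.suc i)))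
      ≈⟨ solve 2 (λ a S → S := con (+ 0) :* a :+ S) refl (fromℤ (δ k Fin.zero)) _ ⟩
    sum (λ i → (0# ∷ u) i * fromℤ (δ k i))
      ≈⟨ sum-cong (λ i → *-congˡ {(0# ∷ u) i} (reflexive (≡.cong fromℤ (δ-sym k i)))) ⟩
    sum (λ i → (0# ∷ u) i * fromℤ (δ i k))            ≈⟨ sum-δ (0# ∷ u) k ⟩
    (0# ∷ u) k                                        ∎

  pair-facet : ∀ (u : Point D) b c j →
    ⟨ u , facet b c j ⟩ ≈ (0# ∷ u) (inject₁ j) * b - (0# ∷ u) (Fin.suc j) * c
  pair-facet u b c j = begin
    ⟨ u , facet b c j ⟩
      ≈⟨ sum-cong (λ i → solve 5 (λ u e b e′ c → u :* (e :* b :- e′ :* c) := u :* e :* b :- u :* e′ :* c)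
           refl (u i) (e i) b (e′ i) c) ⟩
    sum (λ i → u i * e i * b - u i * e′ i * c)
      ≈⟨ sum-minus (λ i → u i * e i * b) (λ i → u i * e′ i * c) ⟩
    sum (λ i → u i * e i * b) - sum (λ i → u i * e′ i * c)
      ≈⟨ +-cong (*-distribʳ-sum b (λ i → u i * e i)) (-‿cong (*-distribʳ-sum c (λ i → u i * e′ i))) ⟨
    sum (λ i → u i * e i) * b - sum (λ i → u i * e′ i) * c
      ≈⟨ +-cong (*-congʳ {b} (pair-δ u (inject₁ j))) (-‿cong (*-congʳ {c} (pair-δ u (Fin.suc j)))) ⟩
    (0# ∷ u) (inject₁ j) * b - (0# ∷ u) (Fin.suc j) * c  ∎
    where
    e e′ : Point D
    e i = fromℤ (δ (inject₁ j) (Fin.suc i))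
    e′ i = fromℤ (δ (Fin.suc j) (Fin.suc i))

  module _ b c j (κb≈σ′ : κ j * b ≈ σ (Fin.suc j)) (κc≈σ : κ j * c ≈ σ (inject₁ j)) where

    -- Clearing the denominator kⱼ turns the pairing inequality into inequality j of `Centred`.
    facet-slack : ∀ u → κ j * (1# - ⟨ u , facet b c j ⟩)
      ≈ (0# ∷ u) (Fin.suc j) * σ (inject₁ j) + (σ (Fin.suc j) - σ (inject₁ j))
        - (0# ∷ u) (inject₁ j) * σ (Fin.suc j)
    facet-slack u = begin
      κ j * (1# - ⟨ u , facet b c j ⟩)   ≈⟨ *-congˡ (+-congˡ (-‿cong (pair-facet u b c j))) ⟩
      κ j * (1# - (U * b - U′ * c))
        ≈⟨ solve 5 (λ κ U b U′ c → κ :* (con (+ 1) :- (U :* b :- U′ :* c))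
             := U′ :* (κ :* c) :+ κ :- U :* (κ :* b)) refl (κ j) U b U′ c ⟩
      U′ * (κ j * c) + κ j - U * (κ j * b) ≈⟨ +-cong (+-cong (*-congˡ κc≈σ) (κ≈ j)) (-‿cong (*-congˡ κb≈σ′)) ⟩
      _ ∎
      where
      U = (0# ∷ u) (inject₁ j)
      U′ = (0# ∷ u) (Fin.suc j)

    facet∈dual : facet b c j ∈ dual Q
    facet∈dual u u∈Q = 0<⇒*-cancelˡ-≤ (0<κ j) (0≤⇒≤ (≤⇒0≤ (proj₁ (Q⇒centred u∈Q) j))
      (trans (solve 2 (λ κ p → κ :* con (+ 1) :- κ :* p := κ :* (con (+ 1) :- p)) refl _ _) (facet-slack u)))

    -- Facet j of `Q` contains every vertex except the one whose truncation is cut right after entry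
    -- j, by `truncate-edge`.
    slack-facet : ∀ m → ¬ m ≡ inject₁ j → 1# - ⟨ vertex m , facet b c j ⟩ ≈ 0#
    slack-facet m m≢j = 0<⇒*-cancelˡ (0<κ j) (begin
      κ j * (1# - ⟨ vertex m , facet b c j ⟩)      ≈⟨ facet-slack (vertex m) ⟩
      _ ≈⟨ +-cong (+-congʳ (*-congʳ (vertex₀ m (Fin.suc j)))) (-‿cong (*-congʳ (vertex₀ m (inject₁ j)))) ⟩
      (1# - T′) * σ (inject₁ j) + (σ (Fin.suc j) - σ (inject₁ j)) - (1# - T) * σ (Fin.suc j)
        ≈⟨ eq₁ (truncate-edge σ m j m≢j) (solve 5 (λ T T′ σ σ′ κ →
             (con (+ 1) :- T′) :* σ :+ (σ′ :- σ) :- (con (+ 1) :- T) :* σ′ :- κ :* con (+ 0)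
               := con (+ 1) :* (T :* σ′ :- T′ :* σ)) refl T T′ (σ (inject₁ j)) (σ (Fin.suc j)) (κ j)) ⟩
      κ j * 0# ∎)
      where
      T = truncate m σ (inject₁ j)
      T′ = truncate m σ (Fin.suc j)

  -- Necessity of the divisibility conditions

  gap∣⇒gap∣next : ∀ {j} → gap s j ∣ s₀∷ s (inject₁ j) → gap s j ∣ s₀∷ s (Fin.suc j)
  gap∣⇒gap∣next {j} g∣ = ≡.subst (gap s j ∣_) (ℕ.m∸n+n≡m (ℕ.<⇒≤ (s₀∷-increasing j)))
    (∣m∣n⇒∣m+n (∣-reflexive ≡.refl) g∣)

  -- The vanishing slacks place v on all facets of dual Q but one, so v is the
  -- opposite vertex (sⱼ₊₁ eⱼ - sⱼ eⱼ₊₁) / kⱼ, and kⱼ divides sⱼ.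
  integralVertex⇒gap∣ : ∀ {j} (v : Vector ℤ D) → (∀ m → ¬ m ≡ inject₁ j → slack (lattice v) m ≈ 0#) →
    gap s j ∣ s₀∷ s (inject₁ j)
  integralVertex⇒gap∣ {j} v slack≈0 = divides ℤ.∣ ℤ.- v j ∣ (≡.trans
      (≡.cong ℤ.∣_∣ (fromℤ-injective {+ s₀∷ s (inject₁ j)} {ℤ.- v j ℤ.* + gap s j} (sym (begin
        fromℤ (ℤ.- v j ℤ.* + gap s j)  ≈⟨ fromℤ-* (ℤ.- v j) (+ gap s j) ⟩
        fromℤ (ℤ.- v j) * κ j          ≈⟨ *-cong (fromℤ-neg (v j)) (κ≈ j) ⟩
        - y′ * (σ′ - σⱼ)               ≈⟨ 0<⇒*-cancelˡ (0<σ (Fin.suc j)) σ′y′κ≈σ′σ ⟩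
        σⱼ                             ∎))))
      (ℤ.abs-* (ℤ.- v j) (+ gap s j)))
    where
    y′ = fromℤ (v j)
    σⱼ = σ (inject₁ j)
    σ′ = σ (Fin.suc j)
    S = slack (lattice v) (inject₁ j)

    -- The slack at j + 1 vanishes as well, and it exceeds `S` by sⱼ₊₁ Yⱼ₊₁, where Yⱼ₊₁ is the entry
    -- `v j`.
    S≈-σ′y′ : S ≈ - (σ′ * y′)
    S≈-σ′y′ = eq₁ (trans (sym (scan-step 0# (λ i → σ i * homogenise (lattice v) i) j))
        (slack≈0 (Fin.suc j) (suc≢inject₁ j)))
      (solve 2 (λ S p → S :- (:- p) := con (+ 1) :* (S :+ p :- con (+ 0))) refl S (σ′ * y′))
      where
      suc≢inject₁ : ∀ {n} (i : Fin n) → ¬ Fin.suc i ≡ inject₁ i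
      suc≢inject₁ i p = ℕ.1+n≢n (≡.trans (≡.cong Fin.toℕ p) (Fin.toℕ-inject₁ i))

    -- The entries of Y sum to 1; after summation by parts only the term carrying the possibly
    -- nonzero slack `S` remains.
    S*[ρ-ρ′]≈1 : S * (ρ (inject₁ j) - ρ (Fin.suc j)) ≈ 1#
    S*[ρ-ρ′]≈1 = sym (begin
      1#                                         ≈⟨ sum-homogenise (lattice v) ⟨
      sum y                                      ≈⟨ sum-cong (λ i → *-identityˡ (y i)) ⟨
      sum (λ i → 1# * y i)                       ≈⟨ weighted-by-slack (lattice v) (λ _ → 1#) ⟩
      ρ D# * 1# * slack (lattice v) D# + sum jumps
        ≈⟨ +-cong (trans (*-congˡ (slack≈0 D# Fin.fromℕ≢inject₁)) (zeroʳ _))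
             (sum-single {f = jumps} j (λ i i≢j → trans (*-congʳ (slack≈0 (inject₁ i)
                 (i≢j ∘ Fin.inject₁-injective))) (zeroˡ _))) ⟩
      0# + S * (ρ (inject₁ j) * 1# - ρ (Fin.suc j) * 1#)
        ≈⟨ solve 3 (λ S ρ ρ′ → con (+ 0) :+ S :* (ρ :* con (+ 1) :- ρ′ :* con (+ 1)) := S :* (ρ :- ρ′))
             refl S _ _ ⟩
      S * (ρ (inject₁ j) - ρ (Fin.suc j))        ∎)
      where
      y = homogenise (lattice v)
      jumps : Vector Carrier D
      jumps i = slack (lattice v) (inject₁ i) * (ρ (inject₁ i) * 1# - ρ (Fin.suc i) * 1#)

    σ′y′κ≈σ′σ : σ′ * (- y′ * (σ′ - σⱼ)) ≈ σ′ * σⱼ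
    σ′y′κ≈σ′σ = begin
      σ′ * (- y′ * (σ′ - σⱼ))
        ≈⟨ solve 3 (λ σ′ y′ e → σ′ :* (:- y′ :* e) := :- (σ′ :* y′) :* e) refl σ′ y′ (σ′ - σⱼ) ⟩
      - (σ′ * y′) * (σ′ - σⱼ)  ≈⟨ *-congʳ S≈-σ′y′ ⟨
      S * (σ′ - σⱼ)
        ≈⟨ eq₂ (σ*ρ (inject₁ j)) (σ*ρ (Fin.suc j)) (solve 5 (λ S σ σ′ ρ ρ′ →
             S :* (σ′ :- σ) :- σ′ :* σ :* (S :* (ρ :- ρ′))
               := (:- S :* σ′) :* (σ :* ρ :- con (+ 1)) :+ S :* σ :* (σ′ :* ρ′ :- con (+ 1)))
             refl S σⱼ σ′ (ρ (inject₁ j)) (ρ (Fin.suc j))) ⟩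
      σ′ * σⱼ * (S * (ρ (inject₁ j) - ρ (Fin.suc j)))  ≈⟨ *-congˡ S*[ρ-ρ′]≈1 ⟩
      σ′ * σⱼ * 1#             ≈⟨ *-identityʳ _ ⟩
      σ′ * σⱼ                  ∎

  dualLatticePolytope⇒gap∣ : IsLatticePolytope (dual Q) → ∀ j → gap s j ∣ s₀∷ s (inject₁ j)
  dualLatticePolytope⇒gap∣ (n , v , dual⊆ , ⊆dual) j with gap s j ∣? s₀∷ s (inject₁ j)
  ... | yes g∣ = g∣
  ... | no  g∤ = case dual⊆ (facet∈dual b c j κb≈σ′ κc≈σ) of λ (a , 0≤a , ∑a , w≋) →
    -- `a i ≤ 0#` unfolds to a refutation of `0# < a i`. Refuting each positive weight in turn makes
    -- the sum of all weights nonpositive, although it is 1.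
    contradiction (<-respʳ-≈ (sym ∑a) 0<1) (sum≤0 (λ i 0<aᵢ → g∤ (integralVertex⇒gap∣ (v i)
      (λ m m≢j → 0<⇒*-cancelˡ 0<aᵢ (begin
        a i * slack (lattice (v i)) m              ≈⟨ *-congˡ (slack≈ (lattice (v i)) m) ⟩
        -- At `vertex m` the point `facet b c j` has slack 0, which is the weighted sum of the
        -- nonnegative slacks of the lattice points; hence each weighted slack vanishes.
        a i * (1# - ⟨ vertex m , lattice (v i) ⟩)  ≈⟨ sum≈0⇒≈0
            (λ i → 0≤* (0≤a i) (≤⇒0≤ (v∈dual i (vertex m) (vertex∈Q m))))
            (trans (sym (slack-combination (vertex m) {facet b c j} a (λ i → lattice (v i)) ∑a w≋))
                (slack-facet b c j κb≈σ′ κc≈σ m m≢j)) i ⟩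
        0#                                         ≈⟨ zeroʳ (a i) ⟨
        a i * 0#                                   ∎)))))
    where
    r = recip (gap s j) {{gap≢0 j}}
    b = r * σ (Fin.suc j)
    c = r * σ (inject₁ j)

    κ*r* : ∀ x → κ j * (r * x) ≈ x
    κ*r* x = eq₁ (*-recip (gap s j) {{gap≢0 j}})
      (solve 3 (λ κ r x → κ :* (r :* x) :- x := x :* (κ :* r :- con (+ 1))) refl (κ j) r x)

    κb≈σ′ : κ j * b ≈ σ (Fin.suc j)
    κb≈σ′ = κ*r* _

    κc≈σ : κ j * c ≈ σ (inject₁ j)
    κc≈σ = κ*r* _

    v∈dual : ∀ i → lattice (v i) ∈ dual Q
    v∈dual i = ⊆dual (vertex∈convexHull (λ i → lattice (v i)) i)

  -- Sufficiency of the divisibility conditions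

  gap∣⇒dualLatticePolytope : (∀ j → gap s j ∣ s₀∷ s (inject₁ j) × gap s j ∣ s₀∷ s (Fin.suc j)) →
    IsLatticePolytope (dual Q)
  gap∣⇒dualLatticePolytope gap∣ = ℕ.suc D , w , dual⊆ , convexHull⊆dual {p = λ j → lattice (w j)} w∈dual
    where
    b c : Fin D → ℕ
    b j = quotient (proj₂ (gap∣ j))
    c j = quotient (proj₁ (gap∣ j))

    κ*quotient : ∀ j {n} (g∣n : gap s j ∣ n) → κ j * fromℕ (quotient g∣n) ≈ fromℕ n
    κ*quotient j {n} (divides q n≡) = begin
      κ j * fromℕ q                  ≈⟨ *-comm _ _ ⟩
      fromℕ q * κ j                  ≈⟨ fromℤ-* (+ q) (+ gap s j) ⟨
      fromℤ (+ q ℤ.* + gap s j)      ≡⟨ ≡.cong fromℤ (ℤ.pos-* q (gap s j)) ⟨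
      fromℕ (q ℕ.* gap s j)          ≡⟨ ≡.cong fromℕ n≡ ⟨
      fromℕ n                        ∎

    -- Entry 0 is e_d, coming from the last facet u_d ≤ 1; entry j + 1 comes from facet j.
    w : Vector (Vector ℤ D) (ℕ.suc D)
    w = (λ i → δ D# (Fin.suc i)) ∷
        (λ j i → δ (inject₁ j) (Fin.suc i) ℤ.* + b j ℤ.- δ (Fin.suc j) (Fin.suc i) ℤ.* + c j)

    w-suc : ∀ j → lattice (w (Fin.suc j)) ≋ facet (fromℕ (b j)) (fromℕ (c j)) j
    w-suc j i = trans (fromℤ-minus (e ℤ.* + b j) (e′ ℤ.* + c j))
      (+-cong (fromℤ-* e (+ b j)) (-‿cong (fromℤ-* e′ (+ c j))))
      where
      e = δ (inject₁ j) (Fin.suc i)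
      e′ = δ (Fin.suc j) (Fin.suc i)

    w∈dual : ∀ j → lattice (w j) ∈ dual Q
    w∈dual Fin.zero    u u∈Q = ≤-resp₂-≈ (sym (pair-δ u D#)) refl (proj₂ (Q⇒centred u∈Q))
    w∈dual (Fin.suc j) u u∈Q = ≤-resp₂-≈ (sum-cong (λ i → *-congˡ {u i} (sym (w-suc j i)))) refl
      (facet∈dual (fromℕ (b j)) (fromℕ (c j)) j
        (κ*quotient j (proj₂ (gap∣ j))) (κ*quotient j (proj₁ (gap∣ j))) u u∈Q)

    module _ {y} (y∈ : y ∈ dual Q) where

      -- The terms of `weighted-by-slack` for g = 1, with the boundary term first to match `w`, and
      -- with 1 / sⱼ - 1 / sⱼ₊₁ written as kⱼ / (sⱼ sⱼ₊₁) to show its sign.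
      a : Vector Carrier (ℕ.suc D)
      a = (ρ D# * slack y D#) ∷ (λ j → slack y (inject₁ j) * (ρ (inject₁ j) * ρ (Fin.suc j) * κ j))

      0≤a : ∀ i → 0# ≤ a i
      0≤a Fin.zero    = 0≤* (<⇒≤ (0<ρ D#)) (0≤slack y∈ D#)
      0≤a (Fin.suc j) = 0≤* (0≤slack y∈ (inject₁ j))
        (0≤* (0≤* (<⇒≤ (0<ρ (inject₁ j))) (<⇒≤ (0<ρ (Fin.suc j)))) (<⇒≤ (0<κ j)))

      ρρ′κ* : ∀ j g g′ → ρ (inject₁ j) * ρ (Fin.suc j) * (g * σ (Fin.suc j) - g′ * σ (inject₁ j))
                           ≈ ρ (inject₁ j) * g - ρ (Fin.suc j) * g′
      ρρ′κ* j g g′ = eq₂ (σ*ρ (inject₁ j)) (σ*ρ (Fin.suc j))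
        (solve 6 (λ σ ρ σ′ ρ′ g g′ → ρ :* ρ′ :* (g :* σ′ :- g′ :* σ) :- (ρ :* g :- ρ′ :* g′)
            := (:- ρ′ :* g′) :* (σ :* ρ :- con (+ 1)) :+ ρ :* g :* (σ′ :* ρ′ :- con (+ 1)))
          refl (σ (inject₁ j)) (ρ (inject₁ j)) (σ (Fin.suc j)) (ρ (Fin.suc j)) g g′)

      ∑a : sum a ≈ 1#
      ∑a = begin
        sum a
          ≈⟨ +-cong (solve 2 (λ ρ S → ρ :* S := ρ :* con (+ 1) :* S) refl (ρ D#) (slack y D#))
               (sum-cong (λ j → *-congˡ {slack y (inject₁ j)}
                 (trans (*-congˡ (trans (κ≈ j) (sym (+-cong (*-identityˡ _) (-‿cong (*-identityˡ _))))))
                 (ρρ′κ* j 1# 1#)))) ⟩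
        _                                  ≈⟨ weighted-by-slack y (λ _ → 1#) ⟨
        sum (λ i → 1# * homogenise y i)    ≈⟨ sum-cong (λ i → *-identityˡ (homogenise y i)) ⟩
        sum (homogenise y)                 ≈⟨ sum-homogenise y ⟩
        1#                                 ∎

      y≋ : y ≋ combination a (λ j → lattice (w j))
      y≋ i = begin
        y i                                     ≈⟨ sum-δ (homogenise y) (Fin.suc i) ⟨
        sum (λ k → homogenise y k * g k)        ≈⟨ sum-cong (λ k → *-comm (homogenise y k) (g k)) ⟩
        sum (λ k → g k * homogenise y k)        ≈⟨ weighted-by-slack y g ⟩
        _
          ≈⟨ +-cong (solve 3 (λ ρ g S → ρ :* g :* S := ρ :* S :* g) refl (ρ D#) (g D#) (slack y D#))
               (sum-cong (λ j → begin
                 S j * (ρ (inject₁ j) * g (inject₁ j) - ρ (Fin.suc j) * g (Fin.suc j))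
                   ≈⟨ *-congˡ (ρρ′κ* j (g (inject₁ j)) (g (Fin.suc j))) ⟨
                 S j * (ρρ′ j * (g (inject₁ j) * σ (Fin.suc j) - g (Fin.suc j) * σ (inject₁ j)))
                   ≈⟨ *-congˡ (*-congˡ (+-cong (*-congˡ (κ*quotient j (proj₂ (gap∣ j))))
                        (-‿cong (*-congˡ (κ*quotient j (proj₁ (gap∣ j))))))) ⟨
                 S j * (ρρ′ j * (g (inject₁ j) * (κ j * fromℕ (b j)) - g (Fin.suc j) * (κ j * fromℕ (c j))))
                   ≈⟨ solve 7 (λ S r g κ b g′ c → S :* (r :* (g :* (κ :* b) :- g′ :* (κ :* c)))
                        := S :* (r :* κ) :* (g :* b :- g′ :* c))
                        refl (S j) (ρρ′ j) (g (inject₁ j)) (κ j) (fromℕ (b j)) (g (Fin.suc j)) (fromℕ (c j)) ⟩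
                 S j * (ρρ′ j * κ j) * facet (fromℕ (b j)) (fromℕ (c j)) j i
                   ≈⟨ *-congˡ (w-suc j i) ⟨
                 S j * (ρρ′ j * κ j) * lattice (w (Fin.suc j)) i ∎)) ⟩
        combination a (λ j → lattice (w j)) i   ∎
        where
        -- Selects entry i + 1 of Y, which is `y i`; entry 0 of Y is 1 - Σ y.
        g : Vector Carrier (ℕ.suc D)
        g k = fromℤ (δ k (Fin.suc i))

        S ρρ′ : Vector Carrier D
        S j = slack y (inject₁ j)
        ρρ′ j = ρ (inject₁ j) * ρ (Fin.suc j)

    dual⊆ : ∀ {y} → y ∈ dual Q → y ∈ convexHull (λ j → lattice (w j))
    dual⊆ y∈ = a y∈ , 0≤a y∈ , ∑a y∈ , y≋ y∈

open import Data.Nat.Base using (_<_; _≤_)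

theorem2p3 : ∀ {ℓ} (ℝ : Reals ℓ) → let open Polytopes ℝ in
    (d : ℕ) → 1 ≤ d →
    (s : Vector ℕ d) (s≢0 : ∀ i → NonZero (s i)) →
    s Preserves Fin._<_ ⟶ _<_ →
    (∃[ Q ] IsFano Q × TranslationEquivalent (lectureHall s s≢0) Q) →
    (∃[ Q ] IsReflexive Q × TranslationEquivalent (lectureHall s s≢0) Q)
    ⇔ (∀ (i : Fin d) → gap s i ∣ s₀∷ s (inject₁ i) × gap s i ∣ s₀∷ s (Fin.suc i))
theorem2p3 ℝ (ℕ.suc d) _ s s≢0 s-increasing (Q , Q-isFano , P∼Q) = mk⇔
  -- A reflexive translate is in particular a Fano translate, so the analysis applies to `Q′`
  -- itself.
  (λ (Q′ , Q′-isReflexive , P∼Q′) →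
    let open FanoTranslate ℝ s s≢0 s-increasing Q′ (isFano Q′-isReflexive) P∼Q′
        gap∣ = dualLatticePolytope⇒gap∣ (dualIsLatticePolytope Q′-isReflexive)
    in λ i → gap∣ i , gap∣⇒gap∣next (gap∣ i))
  (λ gap∣ →
    let open FanoTranslate ℝ s s≢0 s-increasing Q Q-isFano P∼Q
    -- The given Fano translate is the reflexive one.
    in Q , record { isFano = Q-isFano ; dualIsLatticePolytope = gap∣⇒dualLatticePolytope gap∣ } , P∼Q)
  where open Polytopes.IsReflexive
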